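{- Let $\lambda$ be a Borel probability measure on $[0,1]$. Let $\mathcal P^1$ and $\mathcal P^2$ be two sequences of partitions that are log-balanced in measure with respect to $\lambda$, with weight functions in measure $f_1$ and $f_2$, respectively, such that all the following hold: (i) $\mathcal P^2$ is self-refining; (ii) $f_2$ is nondecreasing; (iii) $f_2(n+1)-f_2(n)=o(f_2(n))$ as $n\to\infty$. Then $$\lim_{n\to\infty}\frac{f_2(L_n(x,\mathcal P^1,\mathcal P^2))}{f_1(n)}=1\quad\text{in measure }(\lambda).$$
   Context: $\mathbb N$ includes $0$. A topological partition of $[0,1]$ is a collection of pairwise disjoint nonempty open intervals the union of whose closures is $[0,1]$. A sequence of partitions $\mathcal P=\{P_n\}_{n\in\mathbb N}$ is a sequence of topological partitions of $[0,1]$; $E=E^{\mathcal P}$ is the set of all endpoints of intervals in all the $P_n$; for $x\in[0,1]\setminus E$, $I_n(x)$ is the unique interval of $P_n$ containing $x$. $\mathcal P$ is self-refining if, for each $n\in\mathbb N$, each interval of $P_{n+1}$ is contained in (possibly equal to) an interval of $P_n$. $\mathcal P$ is log-balanced in measure with respect to a Borel probability measure $\lambda$ on $[0,1]$ if $\lambda(E)=0$ and there is $f:\mathbb N\to\mathbb R$ with $f(n)\to+\infty$ such that $\frac{ -\log\lambda(I_n(x))}{f(n)}\to1$ in $\lambda$-measure as $n\to\infty$; any such $f$ is called a weight function in measure of $\mathcal P$ with respect to $\lambda$. For sequences of partitions $\mathcal P^1,\mathcal P^2$ with endpoint sets $E^1,E^2$ and intervals $I_n^1(x),I_n^2(x)$,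 the Lochs index is $L_n(x,\mathcal P^1,\mathcal P^2)=\sup\{\ell\in\mathbb N : I_n^1(x)\subseteq I_\ell^2(x)\}$ (supremum in $\mathbb N\cup\{\infty\}$) for $x\in[0,1]\setminus(E^1\cup E^2)$. When both sequences are log-balanced in measure with respect to $\lambda$, it is finite for $\lambda$-a.e. $x$, so $f_2(L_n(x,\mathcal P^1,\mathcal P^2))$ is defined for a.e. $x$. -}

module Defs where

open import Level using (0ℓ)
open import Algebra.Bundles using (CommutativeRing; Semiring)
open import Algebra.Definitions.RawMonoid as RawMonoidDefs using ()
open import Algebra.Definitions.RawSemiring as RawSemiringDefs using ()
open import Algebra.Construct.NaturalChoice.Max as Max using ()
open import Data.Empty using (⊥-elim)
open import Data.Fin.Base using (toℕ)
open import Data.Nat.Base as ℕ using (ℕ; suc)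
open import Data.Product using (Σ-syntax; ∃; ∃-syntax; _×_; _,_; proj₁; proj₂)
open import Data.Sum.Base using (_⊎_; inj₁; inj₂)
open import Function.Bundles using (_⇔_; Equivalence)
open import Relation.Binary.Bundles using (StrictTotalOrder; DecTotalOrder)
open import Relation.Binary.Core using (Rel)
open import Relation.Binary.Properties.StrictTotalOrder as STOProperties using ()
open import Relation.Binary.PropositionalEquality.Core using (_≢_)
open import Relation.Binary.Structures using (IsStrictTotalOrder)
open import Relation.Nullary.Negation.Core using (¬_)
open import Relation.Unary using (Pred; _∈_; _∉_; _⊆_; _≐_; _∩_; ∁; ⋃; U; Empty)

-- The real line, axiomatised as a Dedekind-complete ordered field (unique up
-- to isomorphism).  Equality is a setoid equality.  The inverse is total, with
-- an unspecified value at 0.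
record CompleteOrderedField : Set₁ where
  infix 4 _<_
  infix 9 _⁻¹

  field
    commutativeRing : CommutativeRing 0ℓ 0ℓ

  open CommutativeRing commutativeRing public
    using (_≈_; _≉_; _+_; _*_; -_; _-_; 0#; 1#)
    renaming (Carrier to ℝ)

  field
    _⁻¹                : ℝ → ℝ
    ⁻¹-cong            : ∀ {x y} → x ≈ y → x ⁻¹ ≈ y ⁻¹
    ⁻¹-inverseʳ        : ∀ {x} → x ≉ 0# → x * x ⁻¹ ≈ 1#
    _<_                : Rel ℝ 0ℓ
    isStrictTotalOrder : IsStrictTotalOrder _≈_ _<_
    0<1                : 0# < 1#
    +-monoˡ-<          : ∀ {x y} z → x < y → x + z < y + z
    *-pos              : ∀ {x y} → 0# < x → 0# < y → 0# < x * y

  strictTotalOrder : StrictTotalOrder 0ℓ 0ℓ 0ℓ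
  strictTotalOrder = record { isStrictTotalOrder = isStrictTotalOrder }

  decTotalOrder : DecTotalOrder 0ℓ 0ℓ 0ℓ
  decTotalOrder = STOProperties.decTotalOrder strictTotalOrder

  open DecTotalOrder decTotalOrder public using (_≤_; totalOrder)

  UpperBound : Pred ℝ 0ℓ → Pred ℝ 0ℓ
  UpperBound S u = ∀ x → x ∈ S → x ≤ u

  field
    complete : (S : Pred ℝ 0ℓ) → ∃ S → ∃ (UpperBound S) →
               ∃[ s ] s ∈ UpperBound S × (∀ u → u ∈ UpperBound S → s ≤ u)

module Partitions (R : CompleteOrderedField) where

  open CompleteOrderedField R public
  open RawMonoidDefs (CommutativeRing.+-rawMonoid commutativeRing) public
    using (sum) renaming (_×_ to _·_)
  open RawSemiringDefs (Semiring.rawSemiring (CommutativeRing.semiring commutativeRing)) public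
    using (_^_)
  open Max totalOrder public using (_⊔_)

  ∣_∣ : ℝ → ℝ
  ∣ x ∣ = x ⊔ (- x)

  infix 4 _⟶_

  _⟶_ : (ℕ → ℝ) → ℝ → Set
  a ⟶ l = ∀ ε → 0# < ε → ∃[ N ] (∀ n → N ℕ.≤ n → ∣ a n - l ∣ < ε)

  _⟶+∞ : (ℕ → ℝ) → Set
  a ⟶+∞ = ∀ M → ∃[ N ] (∀ n → N ℕ.≤ n → M < a n)

  _=o_ : (ℕ → ℝ) → (ℕ → ℝ) → Set
  a =o b = ∀ ε → 0# < ε → ∃[ N ] (∀ n → N ℕ.≤ n → ∣ a n ∣ ≤ ε * ∣ b n ∣)

  -- exp y = lim (1 + y / m) ^ m, with m = n + 1.
  IsExp : ℝ → ℝ → Set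
  IsExp y x = (λ n → (1# + y * (suc n · 1#) ⁻¹) ^ suc n) ⟶ x

  -- y is the natural logarithm of x; no y qualifies when x ≤ 0.
  IsLog : ℝ → ℝ → Set
  IsLog x y = IsExp y x

  Point : Set
  Point = Σ[ x ∈ ℝ ] (0# ≤ x × x ≤ 1#)

  record Interval : Set where
    field
      left       : ℝ
      right      : ℝ
      left<right : left < right

  open Interval public

  ⟦_⟧ : Interval → Pred Point 0ℓ
  ⟦ J ⟧ x = left J < proj₁ x × proj₁ x < right J

  -- The subspace topology on [0,1]; in particular open sets respect _≈_.
  IsOpen : Pred Point 0ℓ → Set
  IsOpen A = ∀ x → x ∈ A → ∃[ J ] x ∈ ⟦ J ⟧ × ⟦ J ⟧ ⊆ A

  -- The σ-algebra generated by the open sets.  Closure under _≐_ is needed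
  -- because predicates are not extensional.
  data Borel : Pred Point 0ℓ → Set₁ where
    isOpen     : ∀ {A} → IsOpen A → Borel A
    complement : ∀ {A} → Borel A → Borel (∁ A)
    union      : ∀ {A : ℕ → Pred Point 0ℓ} → (∀ k → Borel (A k)) → Borel (⋃ ℕ A)
    resp       : ∀ {A B} → A ≐ B → Borel A → Borel B

  borel-⟦_⟧ : ∀ J → Borel ⟦ J ⟧
  borel-⟦ J ⟧ = isOpen (λ x x∈J → J , x∈J , λ z∈J → z∈J)

  record BorelProbability : Set₁ where
    field
      measure     : (A : Pred Point 0ℓ) → Borel A → ℝ
      cong        : ∀ {A B} (a : Borel A) (b : Borel B) → A ≐ B →
                    measure A a ≈ measure B b
      nonNegative : ∀ {A} (a : Borel A) → 0# ≤ measure A a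
      total       : (u : Borel U) → measure U u ≈ 1#
      additive    : (A : ℕ → Pred Point 0ℓ) (a : ∀ k → Borel (A k)) →
                    (∀ {j k} → j ≢ k → Empty (A j ∩ A k)) →
                    (λ n → sum {n} (λ i → measure (A (toℕ i)) (a (toℕ i))))
                      ⟶ measure (⋃ ℕ A) (union a)

  open BorelProbability public using (measure)

  -- Graph of a real-valued function defined on part of [0,1].
  PartialFunction : Set₁
  PartialFunction = Point → ℝ → Set

  -- Points at distance > ε from c.  Points where h is undefined are included;
  -- for an almost everywhere defined h this only adds a null set.
  Deviation : PartialFunction → ℝ → ℝ → Pred Point 0ℓ
  Deviation h c ε x = ¬ (∃[ v ] h x v × ∣ v - c ∣ ≤ ε)

  InMeasure : BorelProbability → (ℕ → PartialFunction) → ℝ → Set₁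
  InMeasure μ h c =
    ∀ ε → 0# < ε →
    Σ[ b ∈ (∀ n → Borel (Deviation (h n) c ε)) ]
      ((λ n → measure μ (Deviation (h n) c ε) (b n)) ⟶ 0#)

  Null : BorelProbability → Pred Point 0ℓ → Set₁
  Null μ A = Σ[ a ∈ Borel A ] measure μ A a ≈ 0#

  -- The closure condition ranges over all of ℝ, so it also forces every
  -- member to be a subinterval of [0,1].
  record Partition : Set₁ where
    field
      member   : Pred Interval 0ℓ
      disjoint : ∀ {J K} → J ∈ member → K ∈ member →
                 ¬ (⟦ J ⟧ ≐ ⟦ K ⟧) → Empty (⟦ J ⟧ ∩ ⟦ K ⟧)
      closures : ∀ x → (∃[ J ] J ∈ member × left J ≤ x × x ≤ right J)
                       ⇔ (0# ≤ x × x ≤ 1#)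

  open Partition public

  PartitionSeq : Set₁
  PartitionSeq = ℕ → Partition

  Endpoints : PartitionSeq → Pred Point 0ℓ
  Endpoints P x = ∃[ n ] ∃[ J ] J ∈ member (P n) ×
                  (left J ≈ proj₁ x ⊎ proj₁ x ≈ right J)

  intervalAt : (P : PartitionSeq) (n : ℕ) (x : Point) → x ∉ Endpoints P →
               ∃[ J ] J ∈ member (P n) × x ∈ ⟦ J ⟧
  intervalAt P n x x∉E with Equivalence.from (closures (P n) (proj₁ x)) (proj₂ x)
  ... | J , J∈P , inj₁ l<x , inj₁ x<r = J , J∈P , l<x , x<r
  ... | J , J∈P , inj₂ l≈x , _        = ⊥-elim (x∉E (n , J , J∈P , inj₁ l≈x))
  ... | J , J∈P , inj₁ _   , inj₂ x≈r = ⊥-elim (x∉E (n , J , J∈P , inj₂ x≈r))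

  I : (P : PartitionSeq) (n : ℕ) (x : Point) → x ∉ Endpoints P → Interval
  I P n x x∉E = proj₁ (intervalAt P n x x∉E)

  SelfRefining : PartitionSeq → Set
  SelfRefining P = ∀ n J → J ∈ member (P (suc n)) →
                   ∃[ K ] K ∈ member (P n) × ⟦ J ⟧ ⊆ ⟦ K ⟧

  -- Undefined at endpoints and where μ(I_n(x)) = 0.
  logRatio : BorelProbability → PartitionSeq → (ℕ → ℝ) → ℕ → PartialFunction
  logRatio μ P f n x v =
    Σ[ x∉E ∈ x ∉ Endpoints P ]
      ∃[ y ] IsLog (measure μ ⟦ I P n x x∉E ⟧ borel-⟦ I P n x x∉E ⟧) y ×
             v ≈ (- y) * f n ⁻¹

  record LogBalancedWithWeight (μ : BorelProbability) (P : PartitionSeq)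
                               (f : ℕ → ℝ) : Set₁ where
    field
      endpoints-null : Null μ (Endpoints P)
      weight⟶+∞     : f ⟶+∞
      ratio⟶1       : InMeasure μ (logRatio μ P f) 1#

  -- Least upper bound in ℕ ∪ {∞}, when finite; in particular sup ∅ = 0.
  IsFiniteSup : Pred ℕ 0ℓ → ℕ → Set
  IsFiniteSup S ℓ = (∀ k → k ∈ S → k ℕ.≤ ℓ) ×
                    (∀ u → (∀ k → k ∈ S → k ℕ.≤ u) → ℓ ℕ.≤ u)

  IsLochsIndex : (P¹ P² : PartitionSeq) (n : ℕ) (x : Point) →
                 x ∉ Endpoints P¹ → x ∉ Endpoints P² → ℕ → Set
  IsLochsIndex P¹ P² n x x∉E¹ x∉E² =
    IsFiniteSup (λ ℓ → ⟦ I P¹ n x x∉E¹ ⟧ ⊆ ⟦ I P² ℓ x x∉E² ⟧)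

  -- Undefined at endpoints and where the Lochs index is infinite.
  lochsRatio : (P¹ P² : PartitionSeq) (f₁ f₂ : ℕ → ℝ) → ℕ → PartialFunction
  lochsRatio P¹ P² f₁ f₂ n x v =
    Σ[ x∉E¹ ∈ x ∉ Endpoints P¹ ] Σ[ x∉E² ∈ x ∉ Endpoints P² ]
      ∃[ ℓ ] IsLochsIndex P¹ P² n x x∉E¹ x∉E² ℓ × v ≈ f₂ ℓ * f₁ n ⁻¹

{-# OPTIONS --safe #-}
module Submission where

-- Given a small δ, compare I¹ₙ(x) with I²ₘ(x), where m is the first time f₂ exceeds (1 ± 4δ) f₁(n).
-- If x is typical for both partitions, log-balancedness makes the two measures differ by a factor
-- of at least 1 + δ f₁(n).  Above the threshold 1 + 4δ the interval I²ₘ(x) is then too small to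
-- contain I¹ₙ(x), so Lₙ(x) < m.  Below the threshold 1 - 4δ the interval I¹ₙ(x) is so much smaller
-- that it can only fail to lie in I²ₘ(x) if it contains an endpoint of it, and the measure of such
-- x is at most 2 / (1 + δ f₁(n)).  Slow growth of f₂ keeps f₂(m) close to the thresholds.

open import Defs
open import Level using (0ℓ; lift; lower) renaming (suc to lsuc)
open import Axiom.ExcludedMiddle using (ExcludedMiddle)
open import Algebra.Bundles using (CommutativeRing)
import Algebra.Construct.NaturalChoice.Max as NaturalMax
import Algebra.Construct.NaturalChoice.MaxOp as MaxOpProperties
import Algebra.Properties.CommutativeSemiring.Exp as SemiringExp
import Algebra.Properties.Ring as RingProperties
import Algebra.Properties.Semiring.Mult as SemiringMult
import Algebra.Properties.Semiring.Mult.TCOptimised as OptimisedMult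
import Algebra.Solver.Ring as RingSolver
open import Algebra.Solver.Ring.AlmostCommutativeRing using (fromCommutativeRing; _-Raw-AlmostCommutative⟶_)
open import Data.Empty using (⊥; ⊥-elim)
open import Data.Integer.Base as ℤ using (ℤ; +_; -[1+_]; _⊖_; _◃_)
import Data.Integer.Properties as ℤₚ
open import Data.Maybe.Base using (map)
open import Data.Nat.Base as ℕ using (ℕ; zero; suc) renaming (_≤_ to _≤ℕ_)
import Data.Nat.Properties as ℕₚ
open import Data.Product using (Σ-syntax; ∃-syntax; _×_; _,_; proj₁; proj₂)
import Data.Sign.Base as Sign
open import Data.Sum.Base as Sum using (_⊎_; inj₁; inj₂)
open import Function.Bundles using (Equivalence)
open import Relation.Binary.Bundles using (StrictTotalOrder; DecTotalOrder)
import Relation.Binary.Construct.StrictToNonStrict as StrictToNonStrict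
open import Relation.Binary.Definitions using (tri<; tri≈; tri>)
open import Relation.Binary.PropositionalEquality.Core as ≡ using (_≢_)
import Relation.Binary.Reasoning.Setoid as SetoidReasoning
import Relation.Binary.Reasoning.StrictPartialOrder as StrictPartialOrderReasoning
open import Relation.Nullary.Decidable using (yes; no; decidable-stable; map′; dec⇒maybe)
open import Relation.Nullary.Negation.Core using (¬_)
open import Relation.Unary using (Pred; _∈_; _∉_; _⊆_; _≐_; _∩_; _∪_; ∁; ⋃; U; Empty)

-- The constant 4 comes from the lower threshold: to first order, one `δ` pays for the log-balance
-- error of each partition, one for the step of `f₂` across the threshold, and one is kept as the
-- additive gap `δ * f₁ n` between the logarithms. Logarithms are available only as a relation, and
-- of the exponential only the linear lower bound `1# + t` is extracted. This suffices because
-- `δ * f₁ n` tends to infinity, so `2 / (1 + δ f₁(n))` still tends to zero. The members of a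
-- partition are given by a predicate, with no enumeration along which masses could be summed. The
-- heavy intervals that matter have mass bounded below, so a finite selection replaces the sum.

module IntegerCoefficients (R : CommutativeRing 0ℓ 0ℓ) where
  open CommutativeRing R
  open RingProperties ring
  open OptimisedMult semiring using (×-homo-+; ×1-homo-*; 1+×) renaming (_×_ to _×′_)
  open SetoidReasoning setoid

  -- With coefficients in ℤ rather than in the ring itself, the solver can decide that 1 - 1 vanishes.
  ⟦_⟧ℤ : ℤ → Carrier
  ⟦ + n      ⟧ℤ = n ×′ 1#
  ⟦ -[1+ n ] ⟧ℤ = - (suc n ×′ 1#)

  cancel-1 : ∀ x y → (1# + x) - (1# + y) ≈ x - y
  cancel-1 x y = begin
    (1# + x) - (1# + y)       ≈⟨ +-cong (+-comm 1# x) (sym (-‿+-comm 1# y)) ⟩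
    (x + 1#) + (- 1# + - y)   ≈⟨ +-assoc x 1# _ ⟩
    x + (1# + (- 1# + - y))   ≈⟨ +-congˡ (sym (+-assoc 1# (- 1#) (- y))) ⟩
    x + ((1# - 1#) + - y)     ≈⟨ +-congˡ (+-congʳ (-‿inverseʳ 1#)) ⟩
    x + (0# + - y)            ≈⟨ +-congˡ (+-identityˡ (- y)) ⟩
    x - y                     ∎

  ⊖-homo : ∀ m n → ⟦ m ⊖ n ⟧ℤ ≈ m ×′ 1# - n ×′ 1#
  ⊖-homo m zero = begin
    m ×′ 1#         ≈⟨ +-identityʳ _ ⟨
    m ×′ 1# + 0#    ≈⟨ +-congˡ -0#≈0# ⟨
    m ×′ 1# - 0#    ∎
  ⊖-homo zero (suc n) = sym (+-identityˡ _)
  ⊖-homo (suc m) (suc n) rewrite ℤₚ.[1+m]⊖[1+n]≡m⊖n m n = begin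
    ⟦ m ⊖ n ⟧ℤ                          ≈⟨ ⊖-homo m n ⟩
    m ×′ 1# - n ×′ 1#                   ≈⟨ cancel-1 _ _ ⟨
    (1# + m ×′ 1#) - (1# + n ×′ 1#)     ≈⟨ +-cong (1+× m 1#) (-‿cong (1+× n 1#)) ⟨
    suc m ×′ 1# - suc n ×′ 1#           ∎

  +-homoℤ : ∀ i j → ⟦ i ℤ.+ j ⟧ℤ ≈ ⟦ i ⟧ℤ + ⟦ j ⟧ℤ
  +-homoℤ (+ m)      (+ n)      = ×-homo-+ 1# m n
  +-homoℤ (+ m)      -[1+ n ]   = ⊖-homo m (suc n)
  +-homoℤ -[1+ m ]   (+ n)      = trans (⊖-homo n (suc m)) (+-comm _ _)
  +-homoℤ -[1+ m ]   -[1+ n ]   = begin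
    - (suc (suc (m ℕ.+ n)) ×′ 1#)        ≡⟨ ≡.cong (λ k → - (suc k ×′ 1#)) (≡.sym (ℕₚ.+-suc m n)) ⟩
    - ((suc m ℕ.+ suc n) ×′ 1#)          ≈⟨ -‿cong (×-homo-+ 1# (suc m) (suc n)) ⟩
    - (suc m ×′ 1# + suc n ×′ 1#)        ≈⟨ -‿+-comm _ _ ⟨
    - (suc m ×′ 1#) + - (suc n ×′ 1#)    ∎

  +◃-homo : ∀ n → ⟦ Sign.+ ◃ n ⟧ℤ ≈ n ×′ 1#
  +◃-homo zero    = refl
  +◃-homo (suc n) = refl

  -◃-homo : ∀ n → ⟦ Sign.- ◃ n ⟧ℤ ≈ - (n ×′ 1#)
  -◃-homo zero    = sym -0#≈0#
  -◃-homo (suc n) = refl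

  *-homoℤ : ∀ i j → ⟦ i ℤ.* j ⟧ℤ ≈ ⟦ i ⟧ℤ * ⟦ j ⟧ℤ
  *-homoℤ (+ m)    (+ n)    = trans (+◃-homo (m ℕ.* n)) (×1-homo-* m n)
  *-homoℤ (+ m)    -[1+ n ] =
    trans (-◃-homo (m ℕ.* suc n)) (trans (-‿cong (×1-homo-* m (suc n))) (-‿distribʳ-* _ _))
  *-homoℤ -[1+ m ] (+ n)    =
    trans (-◃-homo (suc m ℕ.* n)) (trans (-‿cong (×1-homo-* (suc m) n)) (-‿distribˡ-* _ _))
  *-homoℤ -[1+ m ] -[1+ n ] = begin
    (suc m ℕ.* suc n) ×′ 1#                  ≈⟨ ×1-homo-* (suc m) (suc n) ⟩
    suc m ×′ 1# * suc n ×′ 1#                ≈⟨ -‿involutive _ ⟨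
    - - (suc m ×′ 1# * suc n ×′ 1#)          ≈⟨ -‿cong (-‿distribˡ-* _ _) ⟩
    - (- (suc m ×′ 1#) * suc n ×′ 1#)        ≈⟨ -‿distribʳ-* _ _ ⟩
    - (suc m ×′ 1#) * - (suc n ×′ 1#)        ∎

  -‿homoℤ : ∀ i → ⟦ ℤ.- i ⟧ℤ ≈ - ⟦ i ⟧ℤ
  -‿homoℤ (+ zero)  = sym -0#≈0#
  -‿homoℤ (+ suc n) = refl
  -‿homoℤ -[1+ n ]  = sym (-‿involutive _)

  morphism : ℤ.+-*-rawRing -Raw-AlmostCommutative⟶ fromCommutativeRing R
  morphism = record
    { ⟦_⟧    = ⟦_⟧ℤ
    ; +-homo = +-homoℤ
    ; *-homo = *-homoℤ
    ; -‿homo = -‿homoℤ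
    ; 0-homo = refl
    ; 1-homo = refl
    }

  open RingSolver ℤ.+-*-rawRing (fromCommutativeRing R) morphism
    (λ i j → map (λ i≡j → reflexive (≡.cong ⟦_⟧ℤ i≡j)) (dec⇒maybe (i ℤₚ.≟ j))) public
    using (solve; _:=_; _:+_; _:*_; _:-_; :-_; con)

-- Arithmetic and order in the real field, up to Bernoulli's inequality.

module OrderedField (R : CompleteOrderedField) where
  open Partitions R public
  open CommutativeRing commutativeRing public
    using (refl; sym; trans; setoid; +-cong; +-congˡ; +-congʳ; *-congˡ; *-congʳ; -‿cong;
           +-comm; +-identityʳ; +-identityˡ; *-assoc; *-comm; *-identityˡ; *-identityʳ; zeroˡ; zeroʳ;
           semiring; commutativeSemiring; -‿inverseʳ)
  open IntegerCoefficients commutativeRing public using (solve; _:=_; _:+_; _:*_; _:-_; :-_; con)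
  open StrictTotalOrder strictTotalOrder public
    using (compare; strictPartialOrder; <-respˡ-≈; <-respʳ-≈)
    renaming (irrefl to <-irrefl; trans to <-trans; asym to <-asym)
  open DecTotalOrder decTotalOrder public using ()
    renaming (refl to ≤-refl; trans to ≤-trans; antisym to ≤-antisym; reflexive to ≤-reflexive; total to ≤-total)
  module OR = StrictPartialOrderReasoning strictPartialOrder
  open StrictToNonStrict _≈_ _<_ public using (<⇒≤)
  open SemiringMult semiring public using (×1-homo-*)
  open SemiringExp commutativeSemiring public using (^-congˡ; ^-assocʳ; ^-distrib-*)
  open MaxOpProperties (NaturalMax.maxOperator totalOrder) public
    using (x≤x⊔y; x≤y⊔x; ⊔-lub; ⊔-sel)

  <-≤-trans : ∀ {x y z} → x < y → y ≤ z → x < z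
  <-≤-trans = StrictToNonStrict.<-≤-trans _≈_ _<_ <-trans <-respʳ-≈

  ≤-<-trans : ∀ {x y z} → x ≤ y → y < z → x < z
  ≤-<-trans = StrictToNonStrict.≤-<-trans _≈_ _<_ sym <-trans <-respˡ-≈

  ≤⇒≯ : ∀ {x y} → x ≤ y → ¬ (y < x)
  ≤⇒≯ x≤y y<x = <-irrefl refl (≤-<-trans x≤y y<x)

  ≮⇒≥ : ∀ {x y} → ¬ (x < y) → y ≤ x
  ≮⇒≥ {x} {y} x≮y with compare x y
  ... | tri< x<y _ _ = ⊥-elim (x≮y x<y)
  ... | tri≈ _ x≈y _ = inj₂ (sym x≈y)
  ... | tri> _ _ y<x = inj₁ y<x

  ≰⇒> : ∀ {x y} → ¬ (x ≤ y) → y < x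
  ≰⇒> {x} {y} x≰y with compare x y
  ... | tri< x<y _ _ = ⊥-elim (x≰y (inj₁ x<y))
  ... | tri≈ _ x≈y _ = ⊥-elim (x≰y (inj₂ x≈y))
  ... | tri> _ _ y<x = y<x

  <-or-≥ : ∀ x y → (x < y) ⊎ (y ≤ x)
  <-or-≥ x y with compare x y
  ... | tri< x<y _ _ = inj₁ x<y
  ... | tri≈ _ x≈y _ = inj₂ (inj₂ (sym x≈y))
  ... | tri> _ _ y<x = inj₂ (inj₁ y<x)

  x<y⇒0<y-x : ∀ {x y} → x < y → 0# < y - x
  x<y⇒0<y-x {x} {y} x<y = <-respˡ-≈ (-‿inverseʳ x) (+-monoˡ-< (- x) x<y)

  x≤y⇒0≤y-x : ∀ {x y} → x ≤ y → 0# ≤ y - x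
  x≤y⇒0≤y-x (inj₁ x<y) = inj₁ (x<y⇒0<y-x x<y)
  x≤y⇒0≤y-x {x} (inj₂ x≈y) = inj₂ (trans (sym (-‿inverseʳ x)) (+-congʳ x≈y))

  -- An inequality x ≤ y is proved by exhibiting a nonnegative d that equals y - x as a polynomial.
  <-from-difference : ∀ {x y d} → 0# < d → y - x ≈ d → x < y
  <-from-difference {x} {y} 0<d y-x≈d =
    <-respˡ-≈ (+-identityˡ x)
      (<-respʳ-≈ (solve 2 (λ x y → (y :- x) :+ x := y) refl x y)
        (+-monoˡ-< x (<-respʳ-≈ (sym y-x≈d) 0<d)))

  ≤-from-difference : ∀ {x y d} → 0# ≤ d → y - x ≈ d → x ≤ y
  ≤-from-difference (inj₁ 0<d) y-x≈d = inj₁ (<-from-difference 0<d y-x≈d)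
  ≤-from-difference {x} {y} (inj₂ 0≈d) y-x≈d = inj₂ (begin
    x            ≈⟨ +-identityˡ x ⟨
    0# + x       ≈⟨ +-congʳ (trans 0≈d (sym y-x≈d)) ⟩
    (y - x) + x  ≈⟨ solve 2 (λ x y → (y :- x) :+ x := y) refl x y ⟩
    y            ∎)
    where open SetoidReasoning setoid

  +-mono-≤ : ∀ {x y u v} → x ≤ y → u ≤ v → x + u ≤ y + v
  +-mono-≤ {x} {y} {u} {v} x≤y u≤v = ≤-trans (step u x≤y) (≤-respˡʳ (step y u≤v))
    where
    step : ∀ {x y} z → x ≤ y → x + z ≤ y + z
    step z (inj₁ x<y) = inj₁ (+-monoˡ-< z x<y)
    step z (inj₂ x≈y) = inj₂ (+-congʳ x≈y)
    ≤-respˡʳ : u + y ≤ v + y → y + u ≤ y + v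
    ≤-respˡʳ p = ≤-trans (≤-reflexive (+-comm y u)) (≤-trans p (≤-reflexive (+-comm v y)))

  +-mono-<-≤ : ∀ {x y u v} → x < y → u ≤ v → x + u < y + v
  +-mono-<-≤ x<y u≤v = <-≤-trans (+-monoˡ-< _ x<y) (+-mono-≤ ≤-refl u≤v)

  +-mono-< : ∀ {x y u v} → x < y → u < v → x + u < y + v
  +-mono-< x<y u<v = +-mono-<-≤ x<y (<⇒≤ u<v)

  +-nonNegative : ∀ {x y} → 0# ≤ x → 0# ≤ y → 0# ≤ x + y
  +-nonNegative 0≤x 0≤y = ≤-trans (≤-reflexive (sym (+-identityˡ 0#))) (+-mono-≤ 0≤x 0≤y)

  +-positive : ∀ {x y} → 0# < x → 0# ≤ y → 0# < x + y
  +-positive 0<x 0≤y = <-respˡ-≈ (+-identityˡ 0#) (+-mono-<-≤ 0<x 0≤y)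

  *-nonNegative : ∀ {x y} → 0# ≤ x → 0# ≤ y → 0# ≤ x * y
  *-nonNegative (inj₁ 0<x) (inj₁ 0<y) = inj₁ (*-pos 0<x 0<y)
  *-nonNegative {x} {y} (inj₂ 0≈x) _ = inj₂ (trans (sym (zeroˡ y)) (*-congʳ 0≈x))
  *-nonNegative {x} {y} _ (inj₂ 0≈y) = inj₂ (trans (sym (zeroʳ x)) (*-congˡ 0≈y))

  *-monoʳ-≤ : ∀ {x y z} → 0# ≤ z → x ≤ y → x * z ≤ y * z
  *-monoʳ-≤ {x} {y} {z} 0≤z x≤y =
    ≤-from-difference (*-nonNegative (x≤y⇒0≤y-x x≤y) 0≤z)
      (solve 3 (λ x y z → y :* z :- x :* z := (y :- x) :* z) refl x y z)

  *-monoˡ-≤ : ∀ {x y z} → 0# ≤ z → x ≤ y → z * x ≤ z * y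
  *-monoˡ-≤ {x} {y} {z} 0≤z x≤y =
    ≤-from-difference (*-nonNegative 0≤z (x≤y⇒0≤y-x x≤y))
      (solve 3 (λ x y z → z :* y :- z :* x := z :* (y :- x)) refl x y z)

  *-monoʳ-< : ∀ {x y z} → 0# < z → x < y → x * z < y * z
  *-monoʳ-< {x} {y} {z} 0<z x<y =
    <-from-difference (*-pos (x<y⇒0<y-x x<y) 0<z)
      (solve 3 (λ x y z → y :* z :- x :* z := (y :- x) :* z) refl x y z)

  *-mono-≤ : ∀ {x y u v} → 0# ≤ u → 0# ≤ y → x ≤ y → u ≤ v → x * u ≤ y * v
  *-mono-≤ 0≤u 0≤y x≤y u≤v = ≤-trans (*-monoʳ-≤ 0≤u x≤y) (*-monoˡ-≤ 0≤y u≤v)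

  *-cancelʳ-≤ : ∀ {x y z} → 0# < z → x * z ≤ y * z → x ≤ y
  *-cancelʳ-≤ 0<z xz≤yz = ≮⇒≥ (λ y<x → ≤⇒≯ xz≤yz (*-monoʳ-< 0<z y<x))

  0<x⇒x≉0 : ∀ {x} → 0# < x → x ≉ 0#
  0<x⇒x≉0 0<x x≈0 = <-irrefl (sym x≈0) 0<x

  *⁻¹ : ∀ {x} → 0# < x → x * x ⁻¹ ≈ 1#
  *⁻¹ 0<x = ⁻¹-inverseʳ (0<x⇒x≉0 0<x)

  x*y⁻¹*y≈x : ∀ {x y} → 0# < y → x * y ⁻¹ * y ≈ x
  x*y⁻¹*y≈x 0<y = trans (*-assoc _ _ _) (trans (*-congˡ (trans (*-comm _ _) (*⁻¹ 0<y))) (*-identityʳ _))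

  ⁻¹-positive : ∀ {x} → 0# < x → 0# < x ⁻¹
  ⁻¹-positive {x} 0<x with <-or-≥ 0# (x ⁻¹)
  ... | inj₁ 0<x⁻¹ = 0<x⁻¹
  ... | inj₂ x⁻¹≤0 = ⊥-elim (≤⇒≯ 1≤0 0<1)
    where
    1≤0 : 1# ≤ 0#
    1≤0 = ≤-trans (≤-reflexive (sym (*⁻¹ 0<x)))
            (≤-trans (*-monoˡ-≤ (<⇒≤ 0<x) x⁻¹≤0) (≤-reflexive (zeroʳ x)))

  0≤1 : 0# ≤ 1#
  0≤1 = <⇒≤ 0<1

  0<2 : 0# < 1# + 1#
  0<2 = +-positive 0<1 0≤1

  ∣x∣<y⇒x<y : ∀ {x y} → ∣ x ∣ < y → x < y
  ∣x∣<y⇒x<y {x} p = ≤-<-trans (x≤x⊔y x (- x)) p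

  ∣x∣<y⇒-x<y : ∀ {x y} → ∣ x ∣ < y → - x < y
  ∣x∣<y⇒-x<y {x} p = ≤-<-trans (x≤y⊔x x (- x)) p

  x≤∣x∣ : ∀ x → x ≤ ∣ x ∣
  x≤∣x∣ x = x≤x⊔y x (- x)

  -x≤∣x∣ : ∀ x → - x ≤ ∣ x ∣
  -x≤∣x∣ x = x≤y⊔x x (- x)

  ∣∣-lub : ∀ {x y} → x ≤ y → - x ≤ y → ∣ x ∣ ≤ y
  ∣∣-lub = ⊔-lub

  ∣∣-lub-< : ∀ {x y} → x < y → - x < y → ∣ x ∣ < y
  ∣∣-lub-< {x} x<y -x<y with ⊔-sel x (- x)
  ... | inj₁ p = <-respˡ-≈ (sym p) x<y
  ... | inj₂ p = <-respˡ-≈ (sym p) -x<y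

  0≤n·1 : ∀ n → 0# ≤ n · 1#
  0≤n·1 zero    = ≤-refl
  0≤n·1 (suc n) = +-nonNegative 0≤1 (0≤n·1 n)

  0<[1+n]·1 : ∀ n → 0# < suc n · 1#
  0<[1+n]·1 n = +-positive 0<1 (0≤n·1 n)

  ·1-mono-≤ : ∀ {m n} → m ≤ℕ n → m · 1# ≤ n · 1#
  ·1-mono-≤ {n = n} ℕ.z≤n = 0≤n·1 n
  ·1-mono-≤ (ℕ.s≤s m≤n) = +-mono-≤ ≤-refl (·1-mono-≤ m≤n)

  ^-positive : ∀ {x} n → 0# < x → 0# < x ^ n
  ^-positive zero    0<x = 0<1
  ^-positive (suc n) 0<x = *-pos 0<x (^-positive n 0<x)

  ^-nonNegative : ∀ {x} n → 0# ≤ x → 0# ≤ x ^ n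
  ^-nonNegative zero    0≤x = 0≤1
  ^-nonNegative (suc n) 0≤x = *-nonNegative 0≤x (^-nonNegative n 0≤x)

  ^-monoˡ-≤ : ∀ {x y} n → 0# ≤ x → x ≤ y → x ^ n ≤ y ^ n
  ^-monoˡ-≤ zero    0≤x x≤y = ≤-refl
  ^-monoˡ-≤ (suc n) 0≤x x≤y =
    *-mono-≤ (^-nonNegative n 0≤x) (≤-trans 0≤x x≤y) x≤y (^-monoˡ-≤ n 0≤x x≤y)

  -- In the induction step the two sides differ by `n` times a square. Negative `x` down to -1 must
  -- be allowed: `exp-positive` applies this to `y * u`, where `y` may be negative.
  bernoulli : ∀ {x} n → 0# ≤ 1# + x → 1# + n · 1# * x ≤ (1# + x) ^ n
  bernoulli {x} zero    0≤1+x = ≤-reflexive (solve 1 (λ x → con (+ 1) :+ con (+ 0) :* x := con (+ 1)) refl x)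
  bernoulli {x} (suc n) 0≤1+x = ≤-trans
    (≤-from-difference (*-nonNegative (0≤n·1 n) 0≤x²)
      (solve 2 (λ x k → (con (+ 1) :+ k :* x) :* (con (+ 1) :+ x) :- (con (+ 1) :+ (con (+ 1) :+ k) :* x)
                    := k :* (x :* x))
        refl x (n · 1#)))
    (≤-trans (*-monoʳ-≤ 0≤1+x (bernoulli n 0≤1+x)) (≤-reflexive (*-comm _ _)))
    where
    0≤x² : 0# ≤ x * x
    0≤x² with ≤-total 0# x
    ... | inj₁ 0≤x = *-nonNegative 0≤x 0≤x
    ... | inj₂ x≤0 = ≤-trans (*-nonNegative 0≤-x 0≤-x) (≤-reflexive (solve 1 (λ x → :- x :* :- x := x :* x) refl x))
      where
      0≤-x : 0# ≤ - x
      0≤-x = ≤-from-difference (x≤y⇒0≤y-x x≤0) (solve 1 (λ x → :- x :- con (+ 0) := con (+ 0) :- x) refl x)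

module Classical (em : ExcludedMiddle (lsuc 0ℓ)) where

  em₀ : ExcludedMiddle 0ℓ
  em₀ = map′ lower lift em

  byContradiction : {A : Set} → ¬ ¬ A → A
  byContradiction = decidable-stable em₀

-- Limits of real sequences.

module Analysis (em : ExcludedMiddle (lsuc 0ℓ)) (R : CompleteOrderedField) where
  open Classical em public
  open OrderedField R public

  archimedean : ∀ x → ∃[ n ] x < n · 1#
  archimedean x with em₀ {∃[ n ] x < n · 1#}
  ... | yes p = p
  ... | no ¬p = ⊥-elim (¬s≤ (λ y y∈S → below y y∈S))
    where
    S : Pred ℝ 0ℓ
    S y = ∃[ n ] y ≈ n · 1#
    bounded : x ∈ UpperBound S
    bounded y (n , y≈n) = ≮⇒≥ (λ x<y → ¬p (n , <-respʳ-≈ y≈n x<y))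
    lub = complete S (0# , 0 , refl) (x , bounded)
    s = proj₁ lub
    below : ∀ y → y ∈ S → y ≤ s - 1#
    below y (n , y≈n) = ≤-trans
      (≤-reflexive (trans y≈n (solve 1 (λ k → k := con (+ 1) :+ k :- con (+ 1)) refl (n · 1#))))
      (+-mono-≤ (proj₁ (proj₂ lub) (suc n · 1#) (suc n , refl)) ≤-refl)
    ¬s≤ : ¬ (s - 1# ∈ UpperBound S)
    ¬s≤ ub = ≤⇒≯ (proj₂ (proj₂ lub) (s - 1#) ub)
      (<-from-difference 0<1 (solve 1 (λ s → s :- (s :- con (+ 1)) := con (+ 1)) refl s))

  ⟶⇒below : ∀ {a l} → a ⟶ l → ∀ {u} → l < u → ∃[ N ] (∀ n → N ≤ℕ n → a n < u)
  ⟶⇒below {a} {l} a⟶l {u} l<u with a⟶l (u - l) (x<y⇒0<y-x l<u)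
  ... | N , close = N , λ n N≤n → <-from-difference (x<y⇒0<y-x (∣x∣<y⇒x<y (close n N≤n)))
    (solve 3 (λ u l a → u :- a := u :- l :- (a :- l)) refl u l (a n))

  ⟶⇒above : ∀ {a l} → a ⟶ l → ∀ {u} → u < l → ∃[ N ] (∀ n → N ≤ℕ n → u < a n)
  ⟶⇒above {a} {l} a⟶l {u} u<l with a⟶l (l - u) (x<y⇒0<y-x u<l)
  ... | N , close = N , λ n N≤n → <-from-difference (x<y⇒0<y-x (∣x∣<y⇒-x<y (close n N≤n)))
    (solve 3 (λ u l a → a :- u := l :- u :- (:- (a :- l))) refl u l (a n))

  -- If the limit were below `c`, so would be all late terms. A bound at arbitrarily late indices is
  -- therefore enough, and `exp-positive` has one only along a subsequence.
  ⟶-≥ : ∀ {a l c} → a ⟶ l → (∀ N → ∃[ n ] N ≤ℕ n × c ≤ a n) → c ≤ l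
  ⟶-≥ a⟶l frequently = ≮⇒≥ λ l<c →
    let N , below = ⟶⇒below a⟶l l<c
        n , N≤n , c≤aₙ = frequently N
    in ≤⇒≯ c≤aₙ (below n N≤n)

  ⟶-mono-≤ : ∀ {a b l m c} → 0# < c → a ⟶ l → b ⟶ m →
             (∃[ N ] (∀ n → N ≤ℕ n → b n * c ≤ a n)) → m * c ≤ l
  ⟶-mono-≤ {a} {b} {l} {m} {c} 0<c a⟶l b⟶m (N , ba) = ≮⇒≥ absurd
    where
    absurd : ¬ (l < m * c)
    absurd l<mc = ≤⇒≯ (ba n (ℕₚ.m≤m⊔n N _))
        (<-trans (belowA n (ℕₚ.≤-trans (ℕₚ.m≤m⊔n N₁ N₂) (ℕₚ.m≤n⊔m N _)))
          (<-≤-trans (<-from-difference (*-pos 0<e 0<1) splitting)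
            (*-monoʳ-≤ (<⇒≤ 0<c) (<⇒≤ (belowB n (ℕₚ.≤-trans (ℕₚ.m≤n⊔m N₁ N₂) (ℕₚ.m≤n⊔m N _)))))))
      where
      0<e' : 0# < m * c - l
      0<e' = x<y⇒0<y-x l<mc
      0<2+c : 0# < 1# + 1# + c
      0<2+c = +-positive 0<2 (<⇒≤ 0<c)
      -- Dividing by `2 + c` leaves `(m - e) * c` exceeding `l + e` by exactly `e`, so terms within
      -- `e` of their limits contradict the termwise bound.
      e = (m * c - l) * (1# + 1# + c) ⁻¹
      0<e : 0# < e
      0<e = *-pos 0<e' (⁻¹-positive 0<2+c)
      A = ⟶⇒below a⟶l {l + e} (<-from-difference 0<e (solve 2 (λ l e → l :+ e :- l := e) refl l e))
      B = ⟶⇒above b⟶m {m - e} (<-from-difference 0<e (solve 2 (λ l e → l :- (l :- e) := e) refl m e))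
      N₁ = proj₁ A
      N₂ = proj₁ B
      belowA = proj₂ A
      belowB = proj₂ B
      n = N ℕ.⊔ (N₁ ℕ.⊔ N₂)
      e[2+c] : e * (1# + 1# + c) ≈ m * c - l
      e[2+c] = x*y⁻¹*y≈x 0<2+c
      splitting : (m - e) * c - (l + e) ≈ e * 1#
      splitting = begin
        (m - e) * c - (l + e)
          ≈⟨ solve 4 (λ m e c l → (m :- e) :* c :- (l :+ e)
                                := (m :* c :- l) :- e :* (con (+ 1) :+ con (+ 1) :+ c) :+ e :* con (+ 1)) refl m e c l ⟩
        (m * c - l) - e * (1# + 1# + c) + e * 1#
          ≈⟨ +-congʳ (+-congˡ (-‿cong e[2+c])) ⟩
        (m * c - l) - (m * c - l) + e * 1#
          ≈⟨ solve 2 (λ x y → x :- x :+ y := y) refl (m * c - l) (e * 1#) ⟩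
        e * 1#  ∎
        where open SetoidReasoning setoid

  ⟶-const : ∀ {a c l} → a ⟶ l → (∃[ N ] (∀ n → N ≤ℕ n → a n ≈ c)) → l ≈ c
  ⟶-const {a} {c} {l} a⟶l (N , a≈c) = ≤-antisym
    (≮⇒≥ λ c<l → let M , above = ⟶⇒above a⟶l c<l in
      <-irrefl (sym (a≈c (N ℕ.⊔ M) (ℕₚ.m≤m⊔n N M))) (above _ (ℕₚ.m≤n⊔m N M)))
    (⟶-≥ a⟶l (λ M → N ℕ.⊔ M , ℕₚ.m≤n⊔m N M , ≤-reflexive (sym (a≈c _ (ℕₚ.m≤m⊔n N M)))))

  -- The exponential limit.

  private
    1+n⁻¹ : ℕ → ℝ
    1+n⁻¹ n = (suc n · 1#) ⁻¹

    0<1+n⁻¹ : ∀ n → 0# < 1+n⁻¹ n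
    0<1+n⁻¹ n = ⁻¹-positive (0<[1+n]·1 n)

    1+y/n-positive : ∀ {y} n → - y < suc n · 1# → 0# < 1# + y * 1+n⁻¹ n
    1+y/n-positive {y} n -y<1+n = <-from-difference
      (*-pos (x<y⇒0<y-x -y<1+n) (0<1+n⁻¹ n))
      (begin
        (1# + y * 1+n⁻¹ n) - 0#                    ≈⟨ +-congʳ (+-congʳ (*⁻¹ (0<[1+n]·1 n))) ⟨
        (suc n · 1# * 1+n⁻¹ n + y * 1+n⁻¹ n) - 0#  ≈⟨ solve 3 (λ k y u → k :* u :+ y :* u :- con (+ 0) := (k :- :- y) :* u)
                                                     refl (suc n · 1#) y (1+n⁻¹ n) ⟩
        (suc n · 1# - - y) * 1+n⁻¹ n               ∎)
      where open SetoidReasoning setoid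

    eventually-1+y/n-positive : ∀ y → ∃[ N ] (∀ n → N ≤ℕ n → 0# < 1# + y * 1+n⁻¹ n)
    eventually-1+y/n-positive y with archimedean (- y)
    ... | N , -y<N = N , λ n N≤n → 1+y/n-positive n (<-≤-trans -y<N (·1-mono-≤ (ℕₚ.m≤n⇒m≤1+n N≤n)))

  -- For z ≤ 0 ≤ t one has (1 + z/m)(1 + t/m) ≤ 1 + (z + t)/m, and (1 + t/m)^m ≥ 1 + t.
  exp-gap : ∀ {y z t a b} → IsExp y a → IsExp z b → z ≤ 0# → 0# ≤ t → z + t ≤ y → b * (1# + t) ≤ a
  exp-gap {y} {z} {t} y⟶a z⟶b z≤0 0≤t z+t≤y =
    ⟶-mono-≤ (+-positive 0<1 0≤t) y⟶a z⟶b (N , compareTerms)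
    where
    N = proj₁ (eventually-1+y/n-positive z)
    compareTerms : ∀ n → N ≤ℕ n → (1# + z * 1+n⁻¹ n) ^ suc n * (1# + t) ≤ (1# + y * 1+n⁻¹ n) ^ suc n
    compareTerms n N≤n = begin
      Z ^ m * (1# + t)                 ≈⟨ *-congˡ (+-congˡ m·t/m) ⟨
      Z ^ m * (1# + m · 1# * (t * u))  ≤⟨ *-monoˡ-≤ (^-nonNegative m 0≤Z) (bernoulli m (<⇒≤ 0<T)) ⟩
      Z ^ m * (1# + t * u) ^ m         ≈⟨ ^-distrib-* Z (1# + t * u) m ⟨
      (Z * (1# + t * u)) ^ m           ≤⟨ ^-monoˡ-≤ m (*-nonNegative 0≤Z (<⇒≤ 0<T)) base ⟩
      (1# + y * u) ^ m                 ∎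
      where
      open OR
      m = suc n
      u = 1+n⁻¹ n
      Z = 1# + z * u
      0≤u : 0# ≤ u
      0≤u = <⇒≤ (0<1+n⁻¹ n)
      0≤Z : 0# ≤ Z
      0≤Z = <⇒≤ (proj₂ (eventually-1+y/n-positive z) n N≤n)
      0<T : 0# < 1# + t * u
      0<T = +-positive 0<1 (*-nonNegative 0≤t 0≤u)
      m·t/m : m · 1# * (t * u) ≈ t
      m·t/m = trans (solve 3 (λ k t u → k :* (t :* u) := t :* (k :* u)) refl (m · 1#) t u)
                (trans (*-congˡ (*⁻¹ (0<[1+n]·1 n))) (*-identityʳ t))
      base : Z * (1# + t * u) ≤ 1# + y * u
      base = ≤-from-difference
        (+-nonNegative (*-nonNegative (x≤y⇒0≤y-x z+t≤y) 0≤u)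
          (*-nonNegative (*-nonNegative (x≤y⇒0≤y-x z≤0) 0≤t) (*-nonNegative 0≤u 0≤u)))
        (solve 4 (λ y z t u → con (+ 1) :+ y :* u :- (con (+ 1) :+ z :* u) :* (con (+ 1) :+ t :* u)
                    := (y :- (z :+ t)) :* u :+ (con (+ 0) :- z) :* t :* (u :* u)) refl y z t u)

  -- Along the multiples m of a fixed k > - y, the terms (1 + y/m)^m are at least (1 + y/k)^k > 0.
  exp-positive : ∀ {y a} → IsExp y a → 0# < a
  exp-positive {y} {a} y⟶a = <-≤-trans (^-positive (suc k) 0<Yₖ) (⟶-≥ y⟶a frequently)
    where
    k = proj₁ (archimedean (- y))
    -y<1+k : - y < suc k · 1#
    -y<1+k = <-≤-trans (proj₂ (archimedean (- y))) (·1-mono-≤ (ℕₚ.n≤1+n k))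
    0<Yₖ : 0# < 1# + y * 1+n⁻¹ k
    0<Yₖ = 1+y/n-positive k -y<1+k
    frequently : ∀ N → ∃[ n ] N ≤ℕ n × (1# + y * 1+n⁻¹ k) ^ suc k ≤ (1# + y * 1+n⁻¹ n) ^ suc n
    frequently q = n , q≤n , (begin
      (1# + y * 1+n⁻¹ k) ^ suc k                         ≈⟨ ^-congˡ (suc k) (+-congˡ rescale) ⟩
      (1# + suc q · 1# * (y * u)) ^ suc k                ≤⟨ ^-monoˡ-≤ (suc k) (≤-trans (<⇒≤ 0<Yₖ) (≤-reflexive (+-congˡ rescale)))
                                                              (bernoulli (suc q) (<⇒≤ (1+y/n-positive n -y<1+n))) ⟩
      ((1# + y * u) ^ suc q) ^ suc k                     ≈⟨ ^-assocʳ (1# + y * u) (suc q) (suc k) ⟩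
      (1# + y * u) ^ suc n                               ∎)
      where
      -- With this `n`, `suc n` is `suc q * suc k` by computation, so the power of exponent `suc n`
      -- splits and Bernoulli is applied to the inner exponent `suc q`.
      n = k ℕ.+ q ℕ.* suc k
      u = 1+n⁻¹ n
      q≤n : q ≤ℕ n
      q≤n = ℕₚ.≤-trans (ℕₚ.m≤m*n q (suc k)) (ℕₚ.m≤n+m (q ℕ.* suc k) k)
      -y<1+n : - y < suc n · 1#
      -y<1+n = <-≤-trans -y<1+k (·1-mono-≤ (ℕ.s≤s (ℕₚ.m≤m+n k _)))
      rescale : y * 1+n⁻¹ k ≈ suc q · 1# * (y * u)
      rescale = begin-equality
        y * v                                   ≈⟨ trans (sym (*-identityʳ _)) (*-congˡ (sym (*⁻¹ (0<[1+n]·1 n)))) ⟩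
        y * v * (suc n · 1# * u)                ≈⟨ *-congˡ (*-congʳ (×1-homo-* (suc q) (suc k))) ⟩
        y * v * (suc q · 1# * suc k · 1# * u)   ≈⟨ solve 5 (λ y v Q K u → y :* v :* (Q :* K :* u) := (K :* v) :* (Q :* (y :* u)))
                                                       refl y v (suc q · 1#) (suc k · 1#) u ⟩
        (suc k · 1# * v) * (suc q · 1# * (y * u)) ≈⟨ trans (*-congʳ (*⁻¹ (0<[1+n]·1 k))) (*-identityˡ _) ⟩
        suc q · 1# * (y * u)                    ∎
        where v = 1+n⁻¹ k
              open OR
      open OR

-- Finite measure calculus derived from countable additivity.

module Probability (em : ExcludedMiddle (lsuc 0ℓ)) (R : CompleteOrderedField)
                   (μ : Partitions.BorelProbability R) where
  open Analysis em R public
  private module μ = BorelProbability μ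

  Event : Set₁
  Event = Σ[ A ∈ Pred Point 0ℓ ] Borel A

  ℙ : Event → ℝ
  ℙ (A , a) = μ.measure A a

  interval : Interval → Event
  interval J = ⟦ J ⟧ , borel-⟦ J ⟧

  ∅ : Pred Point 0ℓ
  ∅ _ = ⊥

  ∅ᵉ : Event
  ∅ᵉ = ∅ , isOpen (λ _ ())

  private
    pair : Pred Point 0ℓ → Pred Point 0ℓ → ℕ → Pred Point 0ℓ
    pair A B 0             = A
    pair A B 1             = B
    pair A B (suc (suc _)) = ∅

    pair-Borel : ∀ {A B} → Borel A → Borel B → ∀ k → Borel (pair A B k)
    pair-Borel a b 0             = a
    pair-Borel a b 1             = b
    pair-Borel a b (suc (suc _)) = proj₂ ∅ᵉ

    pair-⋃ : ∀ {A B} → ⋃ ℕ (pair A B) ≐ A ∪ B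
    pair-⋃ = (λ { (0 , x∈A) → inj₁ x∈A ; (1 , x∈B) → inj₂ x∈B })
           , (λ { (inj₁ x∈A) → 0 , x∈A ; (inj₂ x∈B) → 1 , x∈B })

    pair-disjoint : ∀ {A B} → Empty (A ∩ B) → ∀ {j k} → j ≢ k → Empty (pair A B j ∩ pair A B k)
    pair-disjoint A∩B=∅ {0}           {0}           j≢k x _           = j≢k ≡.refl
    pair-disjoint A∩B=∅ {0}           {1}           j≢k x x∈          = A∩B=∅ x x∈
    pair-disjoint A∩B=∅ {1}           {0}           j≢k x (x∈B , x∈A) = A∩B=∅ x (x∈A , x∈B)
    pair-disjoint A∩B=∅ {1}           {1}           j≢k x _           = j≢k ≡.refl
    pair-disjoint A∩B=∅ {suc (suc _)} {_}           j≢k x (() , _)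
    pair-disjoint A∩B=∅ {0}           {suc (suc _)} j≢k x (_ , ())
    pair-disjoint A∩B=∅ {1}           {suc (suc _)} j≢k x (_ , ())

  infixr 6 _∪ᵉ_

  _∪ᵉ_ : Event → Event → Event
  (A , a) ∪ᵉ (B , b) = A ∪ B , resp pair-⋃ (union (pair-Borel a b))

  ∁ᵉ : Event → Event
  ∁ᵉ (A , a) = ∁ A , complement a

  ℙ-nonNegative : ∀ A → 0# ≤ ℙ A
  ℙ-nonNegative (A , a) = μ.nonNegative a

  -- This has to precede finite additivity, which pads two events with empty ones. A constant
  -- sequence of empty sets gives convergent partial sums of a constant `c`; if `c` were positive,
  -- the sums of `n` and of `n + 2` terms would both lie within `c` of the limit and yet differ by
  -- `2c`.
  ℙ-∅ : ℙ ∅ᵉ ≈ 0#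
  ℙ-∅ = ≤-antisym (≮⇒≥ absurd) (ℙ-nonNegative ∅ᵉ)
    where
    c = ℙ ∅ᵉ
    l = μ.measure (⋃ ℕ (λ _ → ∅)) (union (λ _ → proj₂ ∅ᵉ))
    sums : (λ n → sum {n} (λ _ → c)) ⟶ l
    sums = μ.additive (λ _ → ∅) (λ _ → proj₂ ∅ᵉ) (λ _ _ ())
    absurd : ¬ (0# < c)
    absurd 0<c = <-asym (below (suc (suc n)) (ℕₚ.≤-trans (ℕₚ.m≤m⊔n N₁ N₂) (ℕₚ.m≤n+m n 2)))
        (<-respˡ-≈ (solve 2 (λ c l → c :+ (c :+ (l :- c)) := l :+ c) refl c l)
          (+c (+c (above n (ℕₚ.m≤n⊔m N₁ N₂)))))
      where
      B = ⟶⇒below sums {l + c} (<-from-difference 0<c (solve 2 (λ l c → l :+ c :- l := c) refl l c))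
      A = ⟶⇒above sums {l - c} (<-from-difference 0<c (solve 2 (λ l c → l :- (l :- c) := c) refl l c))
      N₁ = proj₁ B
      N₂ = proj₁ A
      below = proj₂ B
      above = proj₂ A
      n = N₁ ℕ.⊔ N₂
      +c : ∀ {x y} → x < y → c + x < c + y
      +c {x} {y} x<y = <-respˡ-≈ (+-comm x c) (<-respʳ-≈ (+-comm y c) (+-monoˡ-< c x<y))

  ℙ-∪-disjoint : ∀ A B → Empty (proj₁ A ∩ proj₁ B) → ℙ (A ∪ᵉ B) ≈ ℙ A + ℙ B
  ℙ-∪-disjoint (A , a) (B , b) A∩B=∅ = trans
    (μ.cong (proj₂ ((A , a) ∪ᵉ (B , b))) (union (pair-Borel a b)) (proj₂ pair-⋃ , proj₁ pair-⋃))
    (⟶-const (μ.additive (pair A B) (pair-Borel a b) (pair-disjoint A∩B=∅)) (2 , sums))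
    where
    null-sum : ∀ n → sum {n} (λ _ → ℙ ∅ᵉ) ≈ 0#
    null-sum zero    = refl
    null-sum (suc n) = trans (+-cong ℙ-∅ (null-sum n)) (+-identityˡ 0#)
    sums : ∀ n → 2 ≤ℕ n → sum {n} _ ≈ ℙ (A , a) + ℙ (B , b)
    sums (suc (suc n)) _ = +-congˡ (trans (+-congˡ (null-sum n)) (+-identityʳ _))
    sums 1 (ℕ.s≤s ())

  private
    infixl 6 _∖ᵉ_

    _∖ᵉ_ : Event → Event → Event
    B ∖ᵉ A = ∁ᵉ (∁ᵉ B ∪ᵉ A)

    ∖-split : ∀ A B → proj₁ A ⊆ proj₁ B → ℙ B ≈ ℙ A + ℙ (B ∖ᵉ A)
    ∖-split A B A⊆B = trans
      (μ.cong (proj₂ B) (proj₂ (A ∪ᵉ (B ∖ᵉ A))) (to , from))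
      (ℙ-∪-disjoint A (B ∖ᵉ A) (λ x (x∈A , x∉) → x∉ (inj₂ x∈A)))
      where
      to : proj₁ B ⊆ proj₁ (A ∪ᵉ (B ∖ᵉ A))
      to {x} x∈B with em₀ {x ∈ proj₁ A}
      ... | yes x∈A = inj₁ x∈A
      ... | no  x∉A = inj₂ λ { (inj₁ x∉B) → x∉B x∈B ; (inj₂ x∈A) → x∉A x∈A }
      from : proj₁ (A ∪ᵉ (B ∖ᵉ A)) ⊆ proj₁ B
      from (inj₁ x∈A) = A⊆B x∈A
      from (inj₂ x∉)  = byContradiction (λ x∉B → x∉ (inj₁ x∉B))

  ℙ-mono : ∀ A B → proj₁ A ⊆ proj₁ B → ℙ A ≤ ℙ B
  ℙ-mono A B A⊆B = ≤-from-difference (ℙ-nonNegative (B ∖ᵉ A))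
    (trans (+-congʳ (∖-split A B A⊆B)) (solve 2 (λ a d → a :+ d :- a := d) refl (ℙ A) (ℙ (B ∖ᵉ A))))

  ℙ-∪ : ∀ A B → ℙ (A ∪ᵉ B) ≤ ℙ A + ℙ B
  ℙ-∪ A B = ≤-trans (≤-reflexive (∖-split A (A ∪ᵉ B) inj₁))
    (+-mono-≤ ≤-refl (ℙ-mono ((A ∪ᵉ B) ∖ᵉ A) B
      (λ {x} x∉ → byContradiction λ x∉B →
        x∉ (inj₁ λ { (inj₁ x∈A) → x∉ (inj₂ x∈A) ; (inj₂ x∈B) → x∉B x∈B }))))

  ℙ≤1 : ∀ A → ℙ A ≤ 1#
  ℙ≤1 A = ≤-trans (ℙ-mono A Uᵉ _) (≤-reflexive (μ.total (proj₂ Uᵉ)))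
    where
    Uᵉ : Event
    Uᵉ = U , resp ((λ _ → _) , (λ _ ())) (complement (proj₂ ∅ᵉ))

  -- Covering arguments over the members of a partition.

  same-interval : ∀ (P : Partition) {J K x} → J ∈ member P → K ∈ member P →
                  x ∈ ⟦ J ⟧ → x ∈ ⟦ K ⟧ → ⟦ J ⟧ ≐ ⟦ K ⟧
  same-interval P {x = x} J∈P K∈P x∈J x∈K =
    byContradiction λ J≠K → disjoint P J∈P K∈P J≠K x (x∈J , x∈K)

  -- Greedily collecting pairwise disjoint heavy intervals, D is the union of those collected so far
  -- and C covers the bad points of D; it stops because each new interval adds at least α to the mass of D.
  cover : (P : Partition) (Heavy : Pred Interval 0ℓ) (Bad : Pred Point 0ℓ) (α γ : ℝ) →
          0# < α → 0# ≤ γ →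
          (∀ K → K ∈ member P → Heavy K →
            α ≤ ℙ (interval K) × (Σ[ A ∈ Event ] ⟦ K ⟧ ∩ Bad ⊆ proj₁ A × ℙ A ≤ γ * ℙ (interval K))) →
          Σ[ C ∈ Event ] (∀ K → K ∈ member P → Heavy K → ⟦ K ⟧ ∩ Bad ⊆ proj₁ C) × ℙ C ≤ γ
  cover P Heavy Bad α γ 0<α 0≤γ local =
    greedy (proj₁ (archimedean (α ⁻¹))) ∅ᵉ ∅ᵉ (λ { (() , _) }) (λ _ ())
      (≤-trans (≤-reflexive ℙ-∅) (*-nonNegative 0≤γ (ℙ-nonNegative ∅ᵉ))) enough
    where
    enough : 1# < proj₁ (archimedean (α ⁻¹)) · 1# * α + ℙ ∅ᵉ
    enough = <-respˡ-≈ (trans (+-identityʳ _) (trans (*-comm _ _) (*⁻¹ 0<α)))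
      (+-mono-<-≤ (*-monoʳ-< 0<α (proj₂ (archimedean (α ⁻¹)))) (ℙ-nonNegative ∅ᵉ))
    greedy : ∀ n (D C : Event) → (proj₁ D ∩ Bad) ⊆ proj₁ C →
             -- `D` contains every member that it meets. Hence, once no heavy member is disjoint
             -- from `D`, every heavy member lies inside `D`, where `C` already catches its bad
             -- points.
             (∀ {K x} → K ∈ member P → x ∈ proj₁ D → x ∈ ⟦ K ⟧ → ⟦ K ⟧ ⊆ proj₁ D) →
             ℙ C ≤ γ * ℙ D → 1# < n · 1# * α + ℙ D →
             Σ[ C ∈ Event ] (∀ K → K ∈ member P → Heavy K → ⟦ K ⟧ ∩ Bad ⊆ proj₁ C) × ℙ C ≤ γ
    -- The fuel hypothesis says that `n` further gains of `α` would push the mass past 1; with no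
    -- rounds left, `D` itself would have mass above 1.
    greedy zero D C covers saturated C≤γD fuel =
      ⊥-elim (≤⇒≯ (ℙ≤1 D) (<-respʳ-≈ (trans (+-congʳ (zeroˡ α)) (+-identityˡ _)) fuel))
    greedy (suc n) D C covers saturated C≤γD fuel
      with em₀ {∃[ K ] K ∈ member P × Heavy K × Empty (⟦ K ⟧ ∩ proj₁ D)}
    ... | no none = C , covered , ≤-trans C≤γD γD≤γ
      where
      γD≤γ : γ * ℙ D ≤ γ
      γD≤γ = ≤-trans (*-monoˡ-≤ 0≤γ (ℙ≤1 D)) (≤-reflexive (*-identityʳ γ))
      covered : ∀ K → K ∈ member P → Heavy K → ⟦ K ⟧ ∩ Bad ⊆ proj₁ C
      covered K K∈P heavy {x} (x∈K , bad) = byContradiction λ x∉C →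
        none (K , K∈P , heavy , λ y (y∈K , y∈D) → x∉C (covers {x} (saturated {x = y} K∈P y∈D y∈K {x} x∈K , bad)))
    ... | yes (K , K∈P , heavy , K∩D=∅) =
      greedy n D′ C′ covers′ saturated′ C′≤γD′ fuel′
      where
      A = proj₁ (proj₂ (local K K∈P heavy))
      D′ = D ∪ᵉ interval K
      C′ = C ∪ᵉ A
      covers′ : (proj₁ D′ ∩ Bad) ⊆ proj₁ C′
      covers′ (inj₁ x∈D , bad) = inj₁ (covers (x∈D , bad))
      covers′ (inj₂ x∈K , bad) = inj₂ (proj₁ (proj₂ (proj₂ (local K K∈P heavy))) (x∈K , bad))
      saturated′ : ∀ {L x} → L ∈ member P → x ∈ proj₁ D′ → x ∈ ⟦ L ⟧ → ⟦ L ⟧ ⊆ proj₁ D′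
      saturated′ {x = x} L∈P (inj₁ x∈D) x∈L {y} y∈L = inj₁ (saturated {x = x} L∈P x∈D x∈L {y} y∈L)
      saturated′ {x = x} L∈P (inj₂ x∈K) x∈L {y} y∈L = inj₂ (proj₁ (same-interval P {x = x} L∈P K∈P x∈L x∈K) {y} y∈L)
      D′-mass : ℙ D′ ≈ ℙ D + ℙ (interval K)
      D′-mass = ℙ-∪-disjoint D (interval K) (λ x (x∈D , x∈K) → K∩D=∅ x (x∈K , x∈D))
      C′≤γD′ : ℙ C′ ≤ γ * ℙ D′
      C′≤γD′ = begin
        ℙ C′                             ≤⟨ ℙ-∪ C A ⟩
        ℙ C + ℙ A                        ≤⟨ +-mono-≤ C≤γD (proj₂ (proj₂ (proj₂ (local K K∈P heavy)))) ⟩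
        γ * ℙ D + γ * ℙ (interval K)     ≈⟨ solve 3 (λ γ d k → γ :* d :+ γ :* k := γ :* (d :+ k)) refl γ _ _ ⟩
        γ * (ℙ D + ℙ (interval K))       ≈⟨ *-congˡ D′-mass ⟨
        γ * ℙ D′                         ∎
        where open OR
      fuel′ : 1# < n · 1# * α + ℙ D′
      fuel′ = begin-strict
        1#                                     <⟨ fuel ⟩
        suc n · 1# * α + ℙ D                   ≈⟨ solve 3 (λ k a d → (con (+ 1) :+ k) :* a :+ d := k :* a :+ (d :+ a))
                                                      refl (n · 1#) α (ℙ D) ⟩
        n · 1# * α + (ℙ D + α)                 ≤⟨ +-mono-≤ ≤-refl (+-mono-≤ ≤-refl (proj₁ (local K K∈P heavy))) ⟩
        n · 1# * α + (ℙ D + ℙ (interval K))    ≈⟨ +-congˡ D′-mass ⟨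
        n · 1# * α + ℙ D′                      ∎
        where open OR

  -- At most one member of Q contains the real number p.
  at-endpoint : (Q : Partition) (p : ℝ) (Light : Pred Interval 0ℓ) (β : ℝ) → 0# ≤ β →
                (∀ J → J ∈ member Q → Light J → ℙ (interval J) ≤ β) →
                Σ[ A ∈ Event ] ℙ A ≤ β ×
                  (∀ J → J ∈ member Q → Light J → left J < p → p < right J → ⟦ J ⟧ ⊆ proj₁ A)
  at-endpoint Q p Light β 0≤β light≤β
    with em₀ {∃[ J ] J ∈ member Q × Light J × left J < p × p < right J}
  ... | no none = ∅ᵉ , ≤-trans (≤-reflexive ℙ-∅) 0≤β ,
                  λ J J∈Q light l<p p<r → ⊥-elim (none (J , J∈Q , light , l<p , p<r))
  ... | yes (J , J∈Q , light , l<p , p<r) = interval J , light≤β J J∈Q light ,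
    λ L L∈Q _ l′<p p<r′ {x} → proj₁ (same-interval Q {x = p , p∈[0,1]} L∈Q J∈Q (l′<p , p<r′) (l<p , p<r)) {x}
    where

    -- The endpoint arrives as a bare real. The closure condition, which ranges over all reals,
    -- turns it into a `Point`, at which disjointness of members can be tested.
    p∈[0,1] : 0# ≤ p × p ≤ 1#
    p∈[0,1] = Equivalence.to (closures Q p) (J , J∈Q , <⇒≤ l<p , <⇒≤ p<r)

  -- If `J` extends beyond `K` on one side, the common point `x` places the endpoint of `K` on that
  -- side strictly inside `J`; if it extends on neither side, it is contained in `K`.
  escapes-through-endpoint : ∀ J K {x} → x ∈ ⟦ J ⟧ → x ∈ ⟦ K ⟧ → ¬ (⟦ J ⟧ ⊆ ⟦ K ⟧) →
    (left J < left K × left K < right J) ⊎ (left J < right K × right K < right J)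
  escapes-through-endpoint J K (lJ<x , x<rJ) (lK<x , x<rK) J⊈K
    with <-or-≥ (left J) (left K) | <-or-≥ (right K) (right J)
  ... | inj₁ lJ<lK | _          = inj₁ (lJ<lK , <-trans lK<x x<rJ)
  ... | inj₂ _     | inj₁ rK<rJ = inj₂ (<-trans lJ<x x<rK , rK<rJ)
  ... | inj₂ lK≤lJ | inj₂ rJ≤rK =
    ⊥-elim (J⊈K λ (lJ<y , y<rJ) → ≤-<-trans lK≤lJ lJ<y , <-≤-trans y<rJ rJ≤rK)

  -- Each includes the existence of a logarithm, and therefore positive mass by `exp-positive`.
  LogAtLeast LogAtMost : ℝ → Pred Interval 0ℓ
  LogAtLeast Y J = ∃[ y ] IsLog (ℙ (interval J)) y × Y ≤ y
  LogAtMost  Y J = ∃[ y ] IsLog (ℙ (interval J)) y × y ≤ Y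

  measure-gap : ∀ {Y Z t J K} → LogAtMost Z J → LogAtLeast Y K → Z ≤ 0# → 0# ≤ t → Z + t ≤ Y →
                ℙ (interval J) * (1# + t) ≤ ℙ (interval K)
  measure-gap (z , z-log , z≤Z) (y , y-log , Y≤y) Z≤0 0≤t Z+t≤Y =
    exp-gap y-log z-log (≤-trans z≤Z Z≤0) 0≤t
      (≤-trans (+-mono-≤ z≤Z ≤-refl) (≤-trans Z+t≤Y Y≤y))

  -- Containment would give `ℙ K * (1 + t) ≤ ℙ K`, which is absurd because `K` has a logarithm and
  -- so positive mass.
  light-⊉-heavy : ∀ {Y Z t J K} → LogAtMost Z K → LogAtLeast Y J → Z ≤ 0# → 0# < t → Z + t ≤ Y →
                  ¬ (⟦ J ⟧ ⊆ ⟦ K ⟧)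
  light-⊉-heavy {t = t} {J} {K} light heavy Z≤0 0<t Z+t≤Y J⊆K =
    ≤⇒≯ (≤-trans (measure-gap light heavy Z≤0 (<⇒≤ 0<t) Z+t≤Y)
                 (ℙ-mono (interval J) (interval K) (λ {x} → J⊆K {x})))
      (<-from-difference (*-pos (exp-positive (proj₁ (proj₂ light))) 0<t)
        (solve 2 (λ k t → k :* (con (+ 1) :+ t) :- k := k :* t) refl (ℙ (interval K)) t))

  -- A light J meeting a heavy K without being contained in it contains an endpoint of K,
  -- so for each K at most two such J occur, of total mass at most 2 μ(K) / (1 + t).
  crossing : (Q P : Partition) (Y Z t : ℝ) → Z ≤ 0# → 0# < t → Z + t ≤ Y →
             Σ[ C ∈ Event ] ℙ C ≤ (1# + 1#) * (1# + t) ⁻¹ ×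
               (∀ J K x → J ∈ member Q → K ∈ member P → LogAtMost Z J → LogAtLeast Y K →
                 x ∈ ⟦ J ⟧ → x ∈ ⟦ K ⟧ → ¬ (⟦ J ⟧ ⊆ ⟦ K ⟧) → x ∈ proj₁ C)
  -- A light `J₀` has positive mass and every heavy `K` outweighs it, so its mass is the uniform
  -- lower bound `α` that makes `cover` stop. Without a light member there is nothing to catch.
  crossing Q P Y Z t Z≤0 0<t Z+t≤Y with em₀ {∃[ J ] J ∈ member Q × LogAtMost Z J}
  ... | no none = ∅ᵉ ,
      ≤-trans (≤-reflexive ℙ-∅) (*-nonNegative (<⇒≤ 0<2) (<⇒≤ (⁻¹-positive (+-positive 0<1 (<⇒≤ 0<t))))) ,
      λ J K x J∈Q _ light _ _ _ _ → ⊥-elim (none (J , J∈Q , light))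
  ... | yes (J₀ , J₀∈Q , light₀@(_ , log₀ , _)) =
    proj₁ covering , proj₂ (proj₂ covering) , λ J K x J∈Q K∈P light heavy x∈J x∈K J⊈K →
      proj₁ (proj₂ covering) K K∈P heavy {x} (x∈K , J , J∈Q , light , x∈J ,
        λ L L∈P x∈L J⊆L → J⊈K λ {z} z∈J → proj₁ (same-interval P {x = x} L∈P K∈P x∈L x∈K) {z} (J⊆L {z} z∈J))
    where
    0<1+t : 0# < 1# + t
    0<1+t = +-positive 0<1 (<⇒≤ 0<t)
    γ = (1# + 1#) * (1# + t) ⁻¹
    0≤γ : 0# ≤ γ
    0≤γ = *-nonNegative (<⇒≤ 0<2) (<⇒≤ (⁻¹-positive 0<1+t))
    -- `cover` needs one bad set for all heavy `K`. Quantifying over every member that contains `x`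
    -- removes the dependence on `K`, and `same-interval` recovers the condition for any particular
    -- one.
    Bad : Pred Point 0ℓ
    Bad x = ∃[ J ] J ∈ member Q × LogAtMost Z J × x ∈ ⟦ J ⟧ ×
            (∀ K → K ∈ member P → x ∈ ⟦ K ⟧ → ¬ (⟦ J ⟧ ⊆ ⟦ K ⟧))
    local : ∀ K → K ∈ member P → LogAtLeast Y K →
            ℙ (interval J₀) ≤ ℙ (interval K) ×
            (Σ[ A ∈ Event ] ⟦ K ⟧ ∩ Bad ⊆ proj₁ A × ℙ A ≤ γ * ℙ (interval K))
    local K K∈P heavy =
      ≤-trans J₀≤ (measure-gap light₀ heavy Z≤0 (<⇒≤ 0<t) Z+t≤Y) ,
      proj₁ Lᵉ ∪ᵉ proj₁ Rᵉ , caught , (begin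
        ℙ (proj₁ Lᵉ ∪ᵉ proj₁ Rᵉ)       ≤⟨ ℙ-∪ (proj₁ Lᵉ) (proj₁ Rᵉ) ⟩
        ℙ (proj₁ Lᵉ) + ℙ (proj₁ Rᵉ)    ≤⟨ +-mono-≤ (proj₁ (proj₂ Lᵉ)) (proj₁ (proj₂ Rᵉ)) ⟩
        β + β                         ≈⟨ solve 2 (λ k u → k :* u :+ k :* u := (con (+ 1) :+ con (+ 1)) :* u :* k)
                                             refl (ℙ (interval K)) ((1# + t) ⁻¹) ⟩
        γ * ℙ (interval K)            ∎)
      where
      open OR
      J₀≤ : ℙ (interval J₀) ≤ ℙ (interval J₀) * (1# + t)
      J₀≤ = ≤-from-difference (*-nonNegative (ℙ-nonNegative (interval J₀)) (<⇒≤ 0<t))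
        (solve 2 (λ k t → k :* (con (+ 1) :+ t) :- k := k :* t) refl (ℙ (interval J₀)) t)
      β = ℙ (interval K) * (1# + t) ⁻¹
      light≤β : ∀ J → J ∈ member Q → LogAtMost Z J → ℙ (interval J) ≤ β
      light≤β J _ light = *-cancelʳ-≤ 0<1+t
        (≤-trans (measure-gap light heavy Z≤0 (<⇒≤ 0<t) Z+t≤Y)
          (≤-reflexive (sym (x*y⁻¹*y≈x 0<1+t))))
      0≤β : 0# ≤ β
      0≤β = *-nonNegative (ℙ-nonNegative (interval K)) (<⇒≤ (⁻¹-positive 0<1+t))
      Lᵉ = at-endpoint Q (left K) (LogAtMost Z) β 0≤β light≤β
      Rᵉ = at-endpoint Q (right K) (LogAtMost Z) β 0≤β light≤β
      caught : ⟦ K ⟧ ∩ Bad ⊆ proj₁ (proj₁ Lᵉ ∪ᵉ proj₁ Rᵉ)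
      caught {x} (x∈K , J , J∈Q , light , x∈J , escapes) =
        Sum.map (λ (l<p , p<r) → proj₂ (proj₂ Lᵉ) J J∈Q light l<p p<r {x} x∈J)
                (λ (l<p , p<r) → proj₂ (proj₂ Rᵉ) J J∈Q light l<p p<r {x} x∈J)
                (escapes-through-endpoint J K {x} x∈J x∈K (escapes K K∈P x∈K))
    covering : Σ[ C ∈ Event ]
      (∀ K → K ∈ member P → LogAtLeast Y K → ⟦ K ⟧ ∩ Bad ⊆ proj₁ C) × ℙ C ≤ γ
    covering = cover P (LogAtLeast Y) Bad (ℙ (interval J₀)) γ (exp-positive log₀) 0≤γ local

-- Intervals around a point, the Lochs index, and choice of levels and tolerances.

module LochsIndex (em : ExcludedMiddle (lsuc 0ℓ)) (R : CompleteOrderedField)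
                  (μ : Partitions.BorelProbability R) where
  open Probability em R μ public
  open LogBalancedWithWeight

  I-member : ∀ P n x (x∉E : x ∉ Endpoints P) → I P n x x∉E ∈ member (P n)
  I-member P n x x∉E = proj₁ (proj₂ (intervalAt P n x x∉E))

  ∈-I : ∀ P n x (x∉E : x ∉ Endpoints P) → x ∈ ⟦ I P n x x∉E ⟧
  ∈-I P n x x∉E = proj₂ (proj₂ (intervalAt P n x x∉E))

  I-cong : ∀ P n x z (x∉E : x ∉ Endpoints P) (z∉E : z ∉ Endpoints P) →
           z ∈ ⟦ I P n x x∉E ⟧ → ⟦ I P n x x∉E ⟧ ≐ ⟦ I P n z z∉E ⟧
  I-cong P n x z x∉E z∉E z∈I =
    same-interval (P n) {x = z} (I-member P n x x∉E) (I-member P n z z∉E) z∈I (∈-I P n z z∉E)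

  -- The coarser member supplied by self-refinement also contains `x`, hence equals the interval of
  -- `x` one level up as a point set.
  I-antitone : ∀ P → SelfRefining P → ∀ x (x∉E : x ∉ Endpoints P) {j k} → j ℕ.≤′ k →
               ⟦ I P k x x∉E ⟧ ⊆ ⟦ I P j x x∉E ⟧
  I-antitone P refining x x∉E ℕ.≤′-refl z∈I = z∈I
  I-antitone P refining x x∉E {j} (ℕ.≤′-step {k} j≤k) {z} z∈I =
    I-antitone P refining x x∉E j≤k {z}
      (proj₁ (same-interval (P k) {x = x} K∈P (I-member P k x x∉E) (I⊆K {x} (∈-I P (suc k) x x∉E)) (∈-I P k x x∉E))
        {z} (I⊆K {z} z∈I))
    where
    coarser = refining k (I P (suc k) x x∉E) (I-member P (suc k) x x∉E)
    K∈P = proj₁ (proj₂ coarser)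
    I⊆K : ⟦ I P (suc k) x x∉E ⟧ ⊆ ⟦ proj₁ coarser ⟧
    I⊆K {z} = proj₂ (proj₂ coarser) {z}

  -- The bound is lowered until it belongs to `S`; reaching 0 is correct even for empty `S`, whose
  -- supremum in ℕ is 0.
  bounded⇒finiteSup : ∀ (S : Pred ℕ 0ℓ) m → (∀ k → k ∈ S → k ≤ℕ m) → ∃[ ℓ ] IsFiniteSup S ℓ
  bounded⇒finiteSup S zero    S≤m = 0 , S≤m , λ _ _ → ℕ.z≤n
  bounded⇒finiteSup S (suc m) S≤1+m with em₀ {suc m ∈ S}
  ... | yes 1+m∈S = suc m , S≤1+m , λ u S≤u → S≤u (suc m) 1+m∈S
  ... | no  1+m∉S = bounded⇒finiteSup S m λ k k∈S →
    ℕₚ.≤-pred (ℕₚ.≤∧≢⇒< (S≤1+m k k∈S) λ { ≡.refl → 1+m∉S k∈S })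

  finiteSup-resp : ∀ {S T : Pred ℕ 0ℓ} {ℓ} → S ≐ T → IsFiniteSup S ℓ → IsFiniteSup T ℓ
  finiteSup-resp (S⊆T , T⊆S) (upper , least) =
    (λ k k∈T → upper k (T⊆S k∈T)) , (λ u T≤u → least u (λ k k∈S → T≤u k (S⊆T k∈S)))

  module _ (P¹ P² : PartitionSeq) where

    Refines : ∀ n x → x ∉ Endpoints P¹ → x ∉ Endpoints P² → Pred ℕ 0ℓ
    Refines n x x∉E¹ x∉E² ℓ = ⟦ I P¹ n x x∉E¹ ⟧ ⊆ ⟦ I P² ℓ x x∉E² ⟧

    -- Containment puts `z` into the `P²` interval of `x` as well, so the two points share both
    -- intervals. Applied in both directions, it shows that they have the same Lochs index.
    Refines-transport : ∀ n x z x∉E¹ x∉E² z∉E¹ z∉E² → z ∈ ⟦ I P¹ n x x∉E¹ ⟧ →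
                        Refines n x x∉E¹ x∉E² ⊆ Refines n z z∉E¹ z∉E²
    Refines-transport n x z x∉E¹ x∉E² z∉E¹ z∉E² z∈I {ℓ} I⊆I {y} y∈I =
      proj₁ (I-cong P² ℓ x z x∉E² z∉E² (I⊆I {z} z∈I)) {y}
        (I⊆I {y} (proj₂ (I-cong P¹ n x z x∉E¹ z∉E¹ z∈I) {y} y∈I))

    -- The Lochs ratio at time n is constant on each interval of P¹ n, up to endpoints.
    Deviation-Borel : ∀ f₁ f₂ n c ε → Borel (Endpoints P¹) → Borel (Endpoints P²) →
                      Borel (Deviation (lochsRatio P¹ P² f₁ f₂ n) c ε)
    Deviation-Borel f₁ f₂ n c ε e¹ e² =
      resp (from , to) (proj₂ (∁ᵉ (O , isOpen O-open) ∪ᵉ (Endpoints P¹ , e¹) ∪ᵉ (Endpoints P² , e²)))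
      where
      Close : Pred Point 0ℓ
      Close x = ∃[ v ] lochsRatio P¹ P² f₁ f₂ n x v × ∣ v - c ∣ ≤ ε
      -- A union of intervals on which closeness holds off the endpoints is open by its very form.
      -- Endpoints are added back separately: the ratio is undefined there, so they count as
      -- deviating.
      O : Pred Point 0ℓ
      O x = ∃[ J ] x ∈ ⟦ J ⟧ × (∀ z → z ∈ ⟦ J ⟧ → z ∉ Endpoints P¹ → z ∉ Endpoints P² → Close z)
      O-open : IsOpen O
      O-open x (J , x∈J , close) = J , x∈J , λ z∈J → J , z∈J , close
      Close⊆O : Close ⊆ O
      Close⊆O {x} (v , (x∉E¹ , x∉E² , ℓ , sup , v≈) , close) = I P¹ n x x∉E¹ , ∈-I P¹ n x x∉E¹ ,
        λ z z∈I z∉E¹ z∉E² → v , (z∉E¹ , z∉E² , ℓ ,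
          finiteSup-resp
            ( (λ {k} → Refines-transport n x z x∉E¹ x∉E² z∉E¹ z∉E² z∈I {k})
            , (λ {k} → Refines-transport n z x z∉E¹ z∉E² x∉E¹ x∉E²
                 (proj₁ (I-cong P¹ n x z x∉E¹ z∉E¹ z∈I) {x} (∈-I P¹ n x x∉E¹)) {k}))
            sup , v≈) , close
      from : (∁ O ∪ (Endpoints P¹ ∪ Endpoints P²)) ⊆ ∁ Close
      from (inj₁ x∉O)         close                         = x∉O (Close⊆O close)
      from (inj₂ (inj₁ x∈E¹)) (_ , (x∉E¹ , _ , _) , _)      = x∉E¹ x∈E¹
      from (inj₂ (inj₂ x∈E²)) (_ , (_ , x∉E² , _) , _)      = x∉E² x∈E²
      to : ∁ Close ⊆ (∁ O ∪ (Endpoints P¹ ∪ Endpoints P²))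
      to {x} x∉Close = byContradiction λ not →
        not (inj₁ λ (J , x∈J , close) → x∉Close (close x x∈J
          (λ x∈E¹ → not (inj₂ (inj₁ x∈E¹))) (λ x∈E² → not (inj₂ (inj₂ x∈E²)))))

    -- By self-refinement the levels whose interval contains `I P¹ n x` are closed downwards, so one
    -- failure at `suc m` bounds them all by `m`. The index then lies between `k` and `m`, and
    -- monotonicity of `f₂` transfers this to the ratio.
    lochs-within : ∀ f₁ f₂ {n k m} → SelfRefining P² → (∀ i j → i ≤ℕ j → f₂ i ≤ f₂ j) →
      ∀ {δ} → 0# < f₁ n → (1# - δ) * f₁ n ≤ f₂ k → f₂ m ≤ (1# + δ) * f₁ n →
      ∀ x x∉E¹ x∉E² → Refines n x x∉E¹ x∉E² k → ¬ Refines n x x∉E¹ x∉E² (suc m) →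
      x ∉ Deviation (lochsRatio P¹ P² f₁ f₂ n) 1# δ
    lochs-within f₁ f₂ {n} {k} {m} refining f₂-mono {δ} 0<F lower upper x x∉E¹ x∉E² k∈S 1+m∉S deviates =
      deviates (v , (x∉E¹ , x∉E² , ℓ , sup , refl) , ∣∣-lub
        (*-cancelʳ-≤ 0<F (≤-from-difference (x≤y⇒0≤y-x (≤-trans (f₂-mono ℓ m (proj₂ sup m S≤m)) upper)) above))
        (*-cancelʳ-≤ 0<F (≤-from-difference
          (x≤y⇒0≤y-x (≤-trans lower (f₂-mono k ℓ (proj₁ sup k (λ {z} → k∈S {z}))))) below)))
      where
      S≤m : ∀ j → j ∈ Refines n x x∉E¹ x∉E² → j ≤ℕ m
      S≤m j j∈S = ℕₚ.≮⇒≥ λ m<j → 1+m∉S λ {z} z∈I →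
        I-antitone P² refining x x∉E² (ℕₚ.≤⇒≤′ m<j) {z} (j∈S {z} z∈I)
      lochs = bounded⇒finiteSup (Refines n x x∉E¹ x∉E²) m S≤m
      ℓ = proj₁ lochs
      sup = proj₂ lochs
      v = f₂ ℓ * f₁ n ⁻¹
      v*F : v * f₁ n ≈ f₂ ℓ
      v*F = x*y⁻¹*y≈x 0<F
      above : δ * f₁ n - (v - 1#) * f₁ n ≈ (1# + δ) * f₁ n - f₂ ℓ
      above = trans (solve 3 (λ δ v F → δ :* F :- (v :- con (+ 1)) :* F := (con (+ 1) :+ δ) :* F :- v :* F) refl δ v (f₁ n))
                (+-congˡ (-‿cong v*F))
      below : δ * f₁ n - - (v - 1#) * f₁ n ≈ f₂ ℓ - (1# - δ) * f₁ n
      below = trans (solve 3 (λ δ v F → δ :* F :- :- (v :- con (+ 1)) :* F := v :* F :- (con (+ 1) :- δ) :* F) refl δ v (f₁ n))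
                (+-congʳ v*F)

  Deviation-antitone : ∀ {h c δ ε} → δ ≤ ε → Deviation h c ε ⊆ Deviation h c δ
  Deviation-antitone δ≤ε deviates (v , hxv , v≤δ) = deviates (v , hxv , ≤-trans v≤δ δ≤ε)

  -- Points where the ratio is undefined count as deviating, so lying outside the deviation set also
  -- yields that `x` is no endpoint and that the mass has a logarithm.
  typical : ∀ P f n δ {x} → 0# < f n → x ∉ Deviation (logRatio μ P f n) 1# δ →
            Σ[ x∉E ∈ x ∉ Endpoints P ] LogAtLeast (- ((1# + δ) * f n)) (I P n x x∉E) ×
                                       LogAtMost (- ((1# - δ) * f n)) (I P n x x∉E)
  typical P f n δ 0<F x∉Dev with byContradiction x∉Dev
  ... | v , (x∉E , y , log , v≈) , close =
    x∉E ,
    (y , log , ≤-from-difference (*-nonNegative (x≤y⇒0≤y-x (≤-trans (x≤∣x∣ _) close)) (<⇒≤ 0<F))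
      (trans (+-congʳ y≈)
        (solve 3 (λ v δ F → :- (v :* F) :- :- ((con (+ 1) :+ δ) :* F) := (δ :- (v :- con (+ 1))) :* F) refl v δ F))) ,
    (y , log , ≤-from-difference (*-nonNegative (x≤y⇒0≤y-x (≤-trans (-x≤∣x∣ _) close)) (<⇒≤ 0<F))
      (trans (+-congˡ (-‿cong y≈))
        (solve 3 (λ v δ F → :- ((con (+ 1) :- δ) :* F) :- :- (v :* F) := (δ :- :- (v :- con (+ 1))) :* F) refl v δ F)))
    where
    F = f n
    y≈ : y ≈ - (v * F)
    y≈ = begin
      y                        ≈⟨ solve 1 (λ y → y := :- (:- y :* con (+ 1))) refl y ⟩
      - (- y * 1#)             ≈⟨ -‿cong (*-congˡ (trans (*-comm _ _) (*⁻¹ 0<F))) ⟨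
      - (- y * (F ⁻¹ * F))     ≈⟨ -‿cong (*-assoc _ _ _) ⟨
      - (- y * F ⁻¹ * F)       ≈⟨ -‿cong (*-congʳ v≈) ⟨
      - (v * F)                ∎
      where open SetoidReasoning setoid

  -- The search descends from a level where `f` exceeds `θ` and must stop above the floor `b`. The
  -- floor is there so that estimates valid from `b` on apply at the level found.
  passage : ∀ {f : ℕ → ℝ} {θ} → f ⟶+∞ → ∀ {b} → f b ≤ θ → ∃[ m ] b ≤ℕ m × f m ≤ θ × θ < f (suc m)
  passage {f} {θ} f→∞ {b} fb≤θ =
    search (proj₁ (f→∞ θ)) (proj₂ (f→∞ θ) _ (ℕₚ.m≤m+n _ b))
    where
    search : ∀ d → θ < f (d ℕ.+ b) → ∃[ m ] b ≤ℕ m × f m ≤ θ × θ < f (suc m)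
    search zero    θ<fb = ⊥-elim (≤⇒≯ fb≤θ θ<fb)
    search (suc d) θ<f with <-or-≥ θ (f (d ℕ.+ b))
    ... | inj₁ θ<f′ = search d θ<f′
    ... | inj₂ f≤θ  = d ℕ.+ b , ℕₚ.m≤n+m b d , f≤θ , θ<f

  fifth : ∀ {m} → 0# < m → ∃[ δ ] 0# < δ × δ + (δ + δ + (δ + δ)) ≈ m
  fifth {m} 0<m = δ , *-pos 0<m (⁻¹-positive (0<[1+n]·1 4)) ,
    trans (solve 2 (λ m u → m :* u :+ (m :* u :+ m :* u :+ (m :* u :+ m :* u)) := m :*
             ((con (+ 1) :+ (con (+ 1) :+ (con (+ 1) :+ (con (+ 1) :+ (con (+ 1) :+ con (+ 0)))))) :* u)) refl m (five ⁻¹))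
          (trans (*-congˡ (*⁻¹ (0<[1+n]·1 4))) (*-identityʳ m))
    where
    five = 5 · 1#
    δ = m * five ⁻¹

  four≤five : ∀ {δ} → 0# < δ → δ + δ + (δ + δ) ≤ δ + (δ + δ + (δ + δ))
  four≤five {δ} 0<δ = ≤-from-difference (<⇒≤ 0<δ)
    (solve 1 (λ δ → δ :+ (δ :+ δ :+ (δ :+ δ)) :- (δ :+ δ :+ (δ :+ δ)) := δ) refl δ)

  -- A fifth of the smaller of `ε` and 1. The bound `5δ ≤ 1` gives `δ ≤ 1 - 4δ`, which later places
  -- the floor level below the lower threshold.
  tolerance : ∀ {ε} → 0# < ε → ∃[ δ ] 0# < δ × (δ + (δ + δ + (δ + δ)) ≤ 1#) × (δ + δ + (δ + δ) ≤ ε)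
  tolerance {ε} 0<ε with <-or-≥ ε 1#
  ... | inj₁ ε<1 = let δ , 0<δ , 5δ≈ε = fifth 0<ε in
    δ , 0<δ , ≤-trans (≤-reflexive 5δ≈ε) (<⇒≤ ε<1) , ≤-trans (four≤five 0<δ) (≤-reflexive 5δ≈ε)
  ... | inj₂ 1≤ε = let δ , 0<δ , 5δ≈1 = fifth 0<1 in
    δ , 0<δ , ≤-reflexive 5δ≈1 , ≤-trans (four≤five 0<δ) (≤-trans (≤-reflexive 5δ≈1) 1≤ε)

-- Threshold estimates and the limit of the Lochs ratio.

module LochsTheorem
  (em : ExcludedMiddle (lsuc 0ℓ)) (R : CompleteOrderedField) (μ : Partitions.BorelProbability R)
  (P¹ P² : Partitions.PartitionSeq R) (f₁ f₂ : ℕ → CompleteOrderedField.ℝ R)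
  (balanced₁ : Partitions.LogBalancedWithWeight R μ P¹ f₁)
  (balanced₂ : Partitions.LogBalancedWithWeight R μ P² f₂)
  (refining : Partitions.SelfRefining R P²)
  (f₂-mono : ∀ m n → m ≤ℕ n → CompleteOrderedField._≤_ R (f₂ m) (f₂ n))
  (slow : Partitions._=o_ R (λ n → CompleteOrderedField._-_ R (f₂ (suc n)) (f₂ n)) f₂)
  where

  open LochsIndex em R μ
  private
    module B₁ = LogBalancedWithWeight balanced₁
    module B₂ = LogBalancedWithWeight balanced₂

  module _ {δ} (0<δ : 0# < δ) (5δ≤1 : δ + (δ + δ + (δ + δ)) ≤ 1#) where

    4δ = δ + δ + (δ + δ)

    0≤1-4δ : 0# ≤ 1# - 4δ
    0≤1-4δ = x≤y⇒0≤y-x (≤-trans (four≤five 0<δ) 5δ≤1)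

    0≤1-δ : 0# ≤ 1# - δ
    0≤1-δ = ≤-trans (+-nonNegative 0≤1-4δ (+-nonNegative (<⇒≤ 0<δ) (+-nonNegative (<⇒≤ 0<δ) (<⇒≤ 0<δ))))
      (≤-reflexive (solve 1 (λ δ → con (+ 1) :- (δ :+ δ :+ (δ :+ δ)) :+ (δ :+ (δ :+ δ)) := con (+ 1) :- δ) refl δ))

    nonPositive : ∀ {x} → 0# ≤ x → - ((1# - δ) * x) ≤ 0#
    nonPositive {x} 0≤x = ≤-from-difference (*-nonNegative 0≤1-δ 0≤x)
      (solve 2 (λ δ x → con (+ 0) :- :- ((con (+ 1) :- δ) :* x) := (con (+ 1) :- δ) :* x) refl δ x)

    -- Rests on `(1 - δ)(1 + 4δ) - (1 + δ) - δ = δ (1 - 4δ)`, whose right side is nonnegative.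
    upper-gap : ∀ {F G} → 0# ≤ F → (1# + 4δ) * F ≤ G → - ((1# - δ) * G) + δ * F ≤ - ((1# + δ) * F)
    upper-gap {F} {G} 0≤F bound = ≤-from-difference
      (+-nonNegative (*-nonNegative 0≤1-δ (x≤y⇒0≤y-x bound)) (*-nonNegative (*-nonNegative (<⇒≤ 0<δ) 0≤1-4δ) 0≤F))
      (solve 3 (λ δ F G → :- ((con (+ 1) :+ δ) :* F) :- (:- ((con (+ 1) :- δ) :* G) :+ δ :* F)
                  := (con (+ 1) :- δ) :* (G :- (con (+ 1) :+ (δ :+ δ :+ (δ :+ δ))) :* F)
                     :+ δ :* (con (+ 1) :- (δ :+ δ :+ (δ :+ δ))) :* F) refl δ F G)

    -- The last summand comes from (1 - 2δ) - (1 + δ)² (1 - 4δ) = δ² (7 + 4δ).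
    lower-gap : ∀ {F g G} → 0# ≤ F → g ≤ (1# - 4δ) * F → G ≤ (1# + δ) * g →
                - ((1# - δ) * F) + δ * F ≤ - ((1# + δ) * G)
    lower-gap {F} {g} {G} 0≤F bound growth = ≤-from-difference
      (+-nonNegative (+-nonNegative
        (*-nonNegative 0≤1+δ (x≤y⇒0≤y-x growth))
        (*-nonNegative (*-nonNegative 0≤1+δ 0≤1+δ) (x≤y⇒0≤y-x bound)))
        (*-nonNegative (*-nonNegative (*-nonNegative 0≤δ 0≤δ) 0≤7+4δ) 0≤F))
      (solve 4 (λ δ F g G → :- ((con (+ 1) :+ δ) :* G) :- (:- ((con (+ 1) :- δ) :* F) :+ δ :* F)
          := (con (+ 1) :+ δ) :* ((con (+ 1) :+ δ) :* g :- G)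
             :+ (con (+ 1) :+ δ) :* (con (+ 1) :+ δ) :* ((con (+ 1) :- (δ :+ δ :+ (δ :+ δ))) :* F :- g)
             :+ δ :* δ :* (con (+ 7) :+ (δ :+ δ :+ (δ :+ δ))) :* F)
        refl δ F g G)
      where
      0≤δ : 0# ≤ δ
      0≤δ = <⇒≤ 0<δ
      0≤1+δ : 0# ≤ 1# + δ
      0≤1+δ = +-nonNegative 0≤1 0≤δ
      0≤7 : 0# ≤ 1# + 1# + 1# + 1# + 1# + 1# + 1#
      0≤7 = +-nonNegative (+-nonNegative (+-nonNegative (+-nonNegative (<⇒≤ (+-positive 0<2 0≤1)) 0≤1) 0≤1) 0≤1) 0≤1
      0≤7+4δ : 0# ≤ 1# + 1# + 1# + 1# + 1# + 1# + 1# + 4δ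
      0≤7+4δ = +-nonNegative 0≤7 (+-nonNegative (+-nonNegative 0≤δ 0≤δ) (+-nonNegative 0≤δ 0≤δ))

    growth : ∀ {n} → 0# < f₂ n → ∣ f₂ (suc n) - f₂ n ∣ ≤ δ * ∣ f₂ n ∣ → f₂ (suc n) ≤ (1# + δ) * f₂ n
    growth {n} 0<fn small = ≤-from-difference
      (x≤y⇒0≤y-x (≤-trans (≤-trans (x≤∣x∣ _) small) (*-monoˡ-≤ (<⇒≤ 0<δ) ∣fn∣≤fn)))
      (solve 3 (λ δ g G → (con (+ 1) :+ δ) :* g :- G := δ :* g :- (G :- g)) refl δ (f₂ n) (f₂ (suc n)))
      where
      ∣fn∣≤fn : ∣ f₂ n ∣ ≤ f₂ n
      ∣fn∣≤fn = ∣∣-lub ≤-refl (≤-from-difference (+-nonNegative (<⇒≤ 0<fn) (<⇒≤ 0<fn))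
        (solve 1 (λ g → g :- :- g := g :+ g) refl (f₂ n)))

    Atypical¹ Atypical² : ℕ → Event
    Atypical¹ n = Deviation (logRatio μ P¹ f₁ n) 1# δ , proj₁ (B₁.ratio⟶1 δ 0<δ) n
    Atypical² n = Deviation (logRatio μ P² f₂ n) 1# δ , proj₁ (B₂.ratio⟶1 δ 0<δ) n

    Lochs-Deviation : ℕ → Pred Point 0ℓ
    Lochs-Deviation n = Deviation (lochsRatio P¹ P² f₁ f₂ n) 1# 4δ

    -- `k` and `m` are the last levels not beyond the two thresholds, so `P²` is compared at `suc k`
    -- and `suc m`. The growth bound at `k` limits the overshoot, keeping the interval at `suc k`
    -- heavy relative to the one of `P¹`.
    atypical-cover : ∀ n k m → 0# < f₁ n →
      0# < f₂ k → f₂ k ≤ (1# - 4δ) * f₁ n → (1# - 4δ) * f₁ n < f₂ (suc k) → f₂ (suc k) ≤ (1# + δ) * f₂ k →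
      f₂ m ≤ (1# + 4δ) * f₁ n → (1# + 4δ) * f₁ n < f₂ (suc m) →
      Σ[ C ∈ Event ] ℙ C ≤ (1# + 1#) * (1# + δ * f₁ n) ⁻¹ ×
        Lochs-Deviation n ⊆ proj₁ (Atypical¹ n ∪ᵉ Atypical² (suc k) ∪ᵉ Atypical² (suc m) ∪ᵉ C)
    atypical-cover n k m 0<F 0<fk fk≤ <fk′ fk′≤ fm≤ <fm′ =
      proj₁ crossed , proj₁ (proj₂ crossed) , λ {x} deviates → byContradiction λ uncovered →
        within x (typical P¹ f₁ n δ 0<F (λ a → uncovered (inj₁ a)))
                 (typical P² f₂ (suc k) δ 0<fk′ (λ a → uncovered (inj₂ (inj₁ a))))
                 (typical P² f₂ (suc m) δ 0<fm′ (λ a → uncovered (inj₂ (inj₂ (inj₁ a)))))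
                 (λ x∈C → uncovered (inj₂ (inj₂ (inj₂ x∈C))))
                 deviates
      where
      F = f₁ n
      0≤F : 0# ≤ F
      0≤F = <⇒≤ 0<F
      0<δF : 0# < δ * F
      0<δF = *-pos 0<δ 0<F
      0<fk′ : 0# < f₂ (suc k)
      0<fk′ = ≤-<-trans (*-nonNegative 0≤1-4δ 0≤F) <fk′
      0<fm′ : 0# < f₂ (suc m)
      0<fm′ = ≤-<-trans (*-nonNegative (+-nonNegative 0≤1 0≤4δ) 0≤F) <fm′
        where
        0≤4δ : 0# ≤ 4δ
        0≤4δ = +-nonNegative (+-nonNegative (<⇒≤ 0<δ) (<⇒≤ 0<δ)) (+-nonNegative (<⇒≤ 0<δ) (<⇒≤ 0<δ))
      crossed = crossing (P¹ n) (P² (suc k)) (- ((1# + δ) * f₂ (suc k))) (- ((1# - δ) * F)) (δ * F)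
        (nonPositive 0≤F) 0<δF (lower-gap 0≤F fk≤ fk′≤)
      within : ∀ x →
        (Σ[ x∉E ∈ x ∉ Endpoints P¹ ] LogAtLeast (- ((1# + δ) * F)) (I P¹ n x x∉E) ×
                                      LogAtMost (- ((1# - δ) * F)) (I P¹ n x x∉E)) →
        (Σ[ x∉E ∈ x ∉ Endpoints P² ] LogAtLeast (- ((1# + δ) * f₂ (suc k))) (I P² (suc k) x x∉E) ×
                                      LogAtMost (- ((1# - δ) * f₂ (suc k))) (I P² (suc k) x x∉E)) →
        (Σ[ x∉E ∈ x ∉ Endpoints P² ] LogAtLeast (- ((1# + δ) * f₂ (suc m))) (I P² (suc m) x x∉E) ×
                                      LogAtMost (- ((1# - δ) * f₂ (suc m))) (I P² (suc m) x x∉E)) →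
        x ∉ proj₁ (proj₁ crossed) → x ∉ Lochs-Deviation n
      within x (x∉E¹ , heavy¹ , light¹) (x∉E² , heavyₖ , _) (x∉E²′ , _ , lightₘ) x∉C =
        lochs-within P¹ P² f₁ f₂ refining f₂-mono 0<F (<⇒≤ <fk′) fm≤ x x∉E¹ x∉E²
          (λ {z} → byContradiction {Refines P¹ P² n x x∉E¹ x∉E² (suc k)}
            (λ J⊈K → x∉C (proj₂ (proj₂ crossed) (I P¹ n x x∉E¹) (I P² (suc k) x x∉E²) x
              (I-member P¹ n x x∉E¹) (I-member P² (suc k) x x∉E²) light¹ heavyₖ
              (∈-I P¹ n x x∉E¹) (∈-I P² (suc k) x x∉E²) J⊈K)) {z})
          -- Typicality at the two levels yields separate proofs that `x` is not an endpoint of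
          -- `P²`; `I-cong` identifies the intervals built from them.
          (λ J⊆K → light-⊉-heavy lightₘ heavy¹ (nonPositive (<⇒≤ 0<fm′)) 0<δF (upper-gap 0≤F (<⇒≤ <fm′))
            λ {z} z∈J → proj₁ (I-cong P² (suc m) x x x∉E² x∉E²′ (∈-I P² (suc m) x x∉E²)) {z} (J⊆K {z} z∈J))

    negligible : ∀ {q t} → 0# < q → 0# < t → (1# + 1#) * q ⁻¹ < t → (1# + 1#) * (1# + t) ⁻¹ ≤ q
    negligible {q} {t} 0<q 0<t 2/q<t = *-cancelʳ-≤ 0<1+t (begin
      (1# + 1#) * (1# + t) ⁻¹ * (1# + t)    ≈⟨ cancel 0<1+t ⟩
      1# + 1#                               ≈⟨ cancel 0<q ⟨
      (1# + 1#) * q ⁻¹ * q                  ≤⟨ *-monoʳ-≤ (<⇒≤ 0<q) (<⇒≤ 2/q<t) ⟩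
      t * q                                 ≤⟨ ≤-from-difference (<⇒≤ 0<q)
                                                 (solve 2 (λ q t → q :* (con (+ 1) :+ t) :- t :* q := q) refl q t) ⟩
      q * (1# + t)                          ∎)
      where
      open OR
      0<1+t : 0# < 1# + t
      0<1+t = +-positive 0<1 (<⇒≤ 0<t)
      cancel : ∀ {x} → 0# < x → (1# + 1#) * x ⁻¹ * x ≈ 1# + 1#
      cancel 0<x = x*y⁻¹*y≈x 0<x

    Lochs-Deviation-small : ∀ {q} → 0# < q →
      ∃[ N ] (∀ n → N ≤ℕ n → Σ[ A ∈ Event ] Lochs-Deviation n ⊆ proj₁ A × ℙ A < q + (q + (q + q)))
    Lochs-Deviation-small {q} 0<q = N₁ ℕ.⊔ N₄ , bound
      where
      small¹ = ⟶⇒below (proj₂ (B₁.ratio⟶1 δ 0<δ)) 0<q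
      small² = ⟶⇒below (proj₂ (B₂.ratio⟶1 δ 0<δ)) 0<q
      slow-δ = slow δ 0<δ
      f₂-positive = B₂.weight⟶+∞ 0#
      N₁ = proj₁ small¹
      -- From this level on the atypical sets of `P²` have mass below `q`, the relative increments
      -- of `f₂` are at most `δ`, and `f₂` is positive.
      b = proj₁ small² ℕ.⊔ (proj₁ slow-δ ℕ.⊔ proj₁ f₂-positive)
      -- Once `δ * f₁ n` exceeds `T`, the first term makes the crossing event at most `q`, and the
      -- second puts `f₂ b` below both thresholds, as `passage` requires.
      T = (1# + 1#) * q ⁻¹ ⊔ f₂ b
      large = B₁.weight⟶+∞ (T * δ ⁻¹)
      N₄ = proj₁ large
      bound : ∀ n → N₁ ℕ.⊔ N₄ ≤ℕ n → Σ[ A ∈ Event ] Lochs-Deviation n ⊆ proj₁ A × ℙ A < q + (q + (q + q))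
      bound n N≤n = Atypical¹ n ∪ᵉ Atypical² (suc k) ∪ᵉ Atypical² (suc m) ∪ᵉ proj₁ C , proj₂ (proj₂ C) ,
        ≤-<-trans (≤-trans (ℙ-∪ _ _) (+-mono-≤ ≤-refl (≤-trans (ℙ-∪ _ _) (+-mono-≤ ≤-refl (ℙ-∪ _ _)))))
          (+-mono-< (proj₂ small¹ n (ℕₚ.m⊔n≤o⇒m≤o N₁ N₄ N≤n))
            (+-mono-< (proj₂ small² (suc k) (≤-base (ℕₚ.m≤m⊔n _ _) k′))
              (+-mono-<-≤ (proj₂ small² (suc m) (≤-base (ℕₚ.m≤m⊔n _ _) m′))
                (≤-trans (proj₁ (proj₂ C)) (negligible 0<q 0<δF (≤-<-trans (x≤x⊔y _ _) T<δF))))))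
        where
        F = f₁ n
        T<δF : T < δ * F
        T<δF = <-respˡ-≈ (x*y⁻¹*y≈x 0<δ)
          (<-respʳ-≈ (*-comm _ _) (*-monoʳ-< 0<δ (proj₂ large n (ℕₚ.m⊔n≤o⇒n≤o N₁ N₄ N≤n))))
        0<δF : 0# < δ * F
        0<δF = <-trans (<-≤-trans (*-pos 0<2 (⁻¹-positive 0<q)) (x≤x⊔y _ _)) T<δF
        0<F : 0# < F
        0<F = ≰⇒> λ F≤0 →
          ≤⇒≯ (≤-trans (*-monoˡ-≤ (<⇒≤ 0<δ) F≤0) (≤-reflexive (zeroʳ δ))) 0<δF
        f₂b≤δF : f₂ b ≤ δ * F
        f₂b≤δF = ≤-trans (x≤y⊔x _ _) (<⇒≤ T<δF)
        low = passage B₂.weight⟶+∞ {b} (≤-trans f₂b≤δF (*-monoʳ-≤ {δ} {1# - 4δ} (<⇒≤ 0<F)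
          (≤-from-difference (x≤y⇒0≤y-x 5δ≤1)
            (solve 1 (λ δ → con (+ 1) :- (δ :+ δ :+ (δ :+ δ)) :- δ := con (+ 1) :- (δ :+ (δ :+ δ :+ (δ :+ δ)))) refl δ))))
        high = passage B₂.weight⟶+∞ {b} (≤-trans f₂b≤δF (*-monoʳ-≤ {δ} {1# + 4δ} (<⇒≤ 0<F)
          (≤-from-difference (+-nonNegative 0≤1 (+-nonNegative (<⇒≤ 0<δ) (+-nonNegative (<⇒≤ 0<δ) (<⇒≤ 0<δ))))
            (solve 1 (λ δ → con (+ 1) :+ (δ :+ δ :+ (δ :+ δ)) :- δ := con (+ 1) :+ (δ :+ (δ :+ δ))) refl δ))))
        k = proj₁ low
        m = proj₁ high
        ≤-base : ∀ {i j} → i ≤ℕ b → b ≤ℕ j → i ≤ℕ suc j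
        ≤-base i≤b b≤j = ℕₚ.m≤n⇒m≤1+n (ℕₚ.≤-trans i≤b b≤j)
        k′ = proj₁ (proj₂ low)
        m′ = proj₁ (proj₂ high)
        0<fk : 0# < f₂ k
        0<fk = proj₂ f₂-positive k (ℕₚ.≤-trans (ℕₚ.≤-trans (ℕₚ.m≤n⊔m (proj₁ slow-δ) _) (ℕₚ.m≤n⊔m (proj₁ small²) _)) k′)
        C = atypical-cover n k m 0<F 0<fk (proj₁ (proj₂ (proj₂ low))) (proj₂ (proj₂ (proj₂ low)))
          (growth 0<fk (proj₂ slow-δ k
            (ℕₚ.≤-trans (ℕₚ.≤-trans (ℕₚ.m≤m⊔n (proj₁ slow-δ) _) (ℕₚ.m≤n⊔m (proj₁ small²) _)) k′)))
          (proj₁ (proj₂ (proj₂ high))) (proj₂ (proj₂ (proj₂ high)))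

  ratio⟶1 : InMeasure μ (lochsRatio P¹ P² f₁ f₂) 1#
  ratio⟶1 ε 0<ε = measurable , limit
    where
    measurable : ∀ n → Borel (Deviation (lochsRatio P¹ P² f₁ f₂ n) 1# ε)
    measurable n = Deviation-Borel P¹ P² f₁ f₂ n 1# ε (proj₁ B₁.endpoints-null) (proj₁ B₂.endpoints-null)
    limit : (λ n → measure μ (Deviation (lochsRatio P¹ P² f₁ f₂ n) 1# ε) (measurable n)) ⟶ 0#
    limit η 0<η =
      let δ , 0<δ , 5δ≤1 , 4δ≤ε = tolerance 0<ε
          -- Three atypical events and the crossing event take one share of `η` each; the fifth is
          -- slack.
          q , 0<q , 5q≈η = fifth 0<η
          N , small = Lochs-Deviation-small 0<δ 5δ≤1 0<q
      in N , λ n N≤n →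
        let A , D⊆A , A<4q = small n N≤n
            D = Deviation (lochsRatio P¹ P² f₁ f₂ n) 1# ε , measurable n
            D<η : ℙ D < η
            D<η = ≤-<-trans (ℙ-mono D A (λ {x} deviates →
                D⊆A {x} (Deviation-antitone {lochsRatio P¹ P² f₁ f₂ n} 4δ≤ε {x} deviates)))
              (<-trans A<4q (<-respʳ-≈ 5q≈η (<-from-difference 0<q
                (solve 1 (λ q → q :+ (q :+ q :+ (q :+ q)) :- (q :+ (q :+ (q :+ q))) := q) refl q))))
        in ∣∣-lub-<
          (<-respˡ-≈ (solve 1 (λ d → d := d :- con (+ 0)) refl (ℙ D)) D<η)
          (≤-<-trans (≤-from-difference (ℙ-nonNegative D)
            (solve 1 (λ d → con (+ 0) :- :- (d :- con (+ 0)) := d) refl (ℙ D))) 0<η)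

theorem6p14 : ExcludedMiddle (lsuc 0ℓ) → (R : CompleteOrderedField) →
    let open Partitions R in
    (μ : BorelProbability) (P¹ P² : PartitionSeq) (f₁ f₂ : ℕ → ℝ) →
    LogBalancedWithWeight μ P¹ f₁ →
    LogBalancedWithWeight μ P² f₂ →
    SelfRefining P² →
    (∀ m n → m ≤ℕ n → f₂ m ≤ f₂ n) →
    (λ n → f₂ (suc n) - f₂ n) =o f₂ →
    InMeasure μ (lochsRatio P¹ P² f₁ f₂) 1#
theorem6p14 em R μ P¹ P² f₁ f₂ balanced₁ balanced₂ refining f₂-mono slow =
  LochsTheorem.ratio⟶1 em R μ P¹ P² f₁ f₂ balanced₁ balanced₂ refining f₂-mono slow
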